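{- The ring $\mathbb Z[x]$ is regularly bi-interpretable with the ring $\mathbb Z$.
   Context: A regular interpretation $(\Gamma,\phi)$ of $\mathbb A$ in $\mathbb B$ is a code of $L(\mathbb B)$-formulas with parameters $\bar y$ defining a subset of $B^n$, an equivalence relation on it and the operations of $\mathbb A$ on the quotient, together with a formula $\phi(\bar y)$ with $\phi(\mathbb B)\ne\emptyset$, such that the resulting structure $\Gamma(\mathbb B,\bar p)\cong\mathbb A$ for every $\bar p\in\phi(\mathbb B)$; a coordinate map is a surjection from the defined subset onto $A$ inducing such an isomorphism. $\mathbb A$ and $\mathbb B$ are regularly bi-interpretable if there are regular interpretations $(\Gamma,\phi)$ of $\mathbb A$ in $\mathbb B$ and $(\Delta,\psi)$ of $\mathbb B$ in $\mathbb A$ and formulas $\theta_{\mathbb A},\theta_{\mathbb B}$ such that for every admissible parameter tuple $\bar r_0$ of the composite interpretation $\Gamma\circ\Delta$ of $\mathbb A$ in $\mathbb A$, $\theta_{\mathbb A}(\bar u,x,\bar r_0)$ defines a coordinate map $\Gamma\circ\Delta(\mathbb A,\bar r_0)\to\mathbb A$, and symmetrically for $\Delta\circ\Gamma$ and $\theta_{\mathbb B}$. -}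

module Defs where

open import Data.Nat using (ℕ; zero; suc; _+_; _*_)
open import Data.Fin using (Fin; remQuot)
open import Data.Product using (Σ; _×_; _,_; uncurry)
open import Data.Sum using (_⊎_)
open import Data.Empty using (⊥)
open import Data.List using (List; []; _∷_; map)
open import Data.Integer as ℤ using (ℤ)
open import Data.Vec.Functional as V using (Vector)
open import Relation.Binary.PropositionalEquality using (_≡_)
open import Function.Bundles using (_⇔_)

data Term (n : ℕ) : Set where
  var : Fin n → Term n
  _⊕_ : Term n → Term n → Term n
  _⊗_ : Term n → Term n → Term n
  ⊖_  : Term n → Term n
  𝟘 𝟙 : Term n

data Formula : ℕ → Set where
  _≐_  : ∀ {n} → Term n → Term n → Formula n
  ⊥f   : ∀ {n} → Formula n
  _∧f_ : ∀ {n} → Formula n → Formula n → Formula n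
  _∨f_ : ∀ {n} → Formula n → Formula n → Formula n
  _⇒f_ : ∀ {n} → Formula n → Formula n → Formula n
  ∀f   : ∀ {n} → Formula (suc n) → Formula n
  ∃f   : ∀ {n} → Formula (suc n) → Formula n

record Str : Set₁ where
  field
    Carrier : Set
    _≈_     : Carrier → Carrier → Set
    _+ₛ_ _*ₛ_ : Carrier → Carrier → Carrier
    -ₛ_     : Carrier → Carrier
    0# 1#   : Carrier

open Str

module _ (S : Str) where
  evalT : ∀ {n} → Term n → (Fin n → Carrier S) → Carrier S
  evalT (var i) ρ = ρ i
  evalT (s ⊕ t) ρ = _+ₛ_ S (evalT s ρ) (evalT t ρ)
  evalT (s ⊗ t) ρ = _*ₛ_ S (evalT s ρ) (evalT t ρ)
  evalT (⊖ t)   ρ = -ₛ_ S (evalT t ρ)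
  evalT 𝟘 ρ = 0# S
  evalT 𝟙 ρ = 1# S

  Sat : ∀ {n} → Formula n → (Fin n → Carrier S) → Set
  Sat (s ≐ t)  ρ = _≈_ S (evalT s ρ) (evalT t ρ)
  Sat ⊥f       ρ = ⊥
  Sat (φ ∧f ψ) ρ = Sat φ ρ × Sat ψ ρ
  Sat (φ ∨f ψ) ρ = Sat φ ρ ⊎ Sat ψ ρ
  Sat (φ ⇒f ψ) ρ = Sat φ ρ → Sat ψ ρ
  Sat (∀f φ)   ρ = (a : Carrier S) → Sat φ (a V.∷ ρ)
  Sat (∃f φ)   ρ = Σ (Carrier S) λ a → Sat φ (a V.∷ ρ)

ℤ-Str : Str
ℤ-Str = record { Carrier = ℤ ; _≈_ = _≡_ ; _+ₛ_ = ℤ._+_ ; _*ₛ_ = ℤ._*_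
               ; -ₛ_ = λ a → ℤ.- a ; 0# = ℤ.0ℤ ; 1# = ℤ.1ℤ }

coeff : List ℤ → ℕ → ℤ
coeff []       _       = ℤ.0ℤ
coeff (a ∷ _)  zero    = a
coeff (_ ∷ p)  (suc i) = coeff p i

padd : List ℤ → List ℤ → List ℤ
padd []       q        = q
padd (a ∷ p)  []       = a ∷ p
padd (a ∷ p)  (b ∷ q)  = (a ℤ.+ b) ∷ padd p q

pneg : List ℤ → List ℤ
pneg = map (λ a → ℤ.- a)

pmul : List ℤ → List ℤ → List ℤ
pmul []      q = []
pmul (a ∷ p) q = padd (map (a ℤ.*_) q) (ℤ.0ℤ ∷ pmul p q)

ℤ[x]-Str : Str
ℤ[x]-Str = record { Carrier = List ℤ
                  ; _≈_ = λ p q → (i : ℕ) → coeff p i ≡ coeff q i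
                  ; _+ₛ_ = padd ; _*ₛ_ = pmul ; -ₛ_ = pneg
                  ; 0# = [] ; 1# = ℤ.1ℤ ∷ [] }

-- Semantic data of an interpreted structure on a set T of tuples:
-- domain, equivalence and graphs of the ring operations.

record Interp (T : Set) : Set₁ where
  field
    Dom        : T → Set
    Eq         : T → T → Set
    Plus Times : T → T → T → Set
    Neg        : T → T → Set
    Zero One   : T → Set

-- f is a coordinate map: a surjection Dom → A inducing an isomorphism
-- of the quotient structure (Dom / Eq, graphs) with A.
record IsCoordMap {T : Set} (I : Interp T) (A : Str)
                  (f : (t : T) → Interp.Dom I t → Carrier A) : Set where
  open Interp I
  field
    cm-surj  : (a : Carrier A) → Σ T λ t → Σ (Dom t) λ d → _≈_ A (f t d) a
    cm-eq    : ∀ t u (d : Dom t) (e : Dom u) → Eq t u ⇔ _≈_ A (f t d) (f u e)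
    cm-plus  : ∀ t u v (d : Dom t) (e : Dom u) (g : Dom v) →
            Plus t u v ⇔ _≈_ A (_+ₛ_ A (f t d) (f u e)) (f v g)
    cm-times : ∀ t u v (d : Dom t) (e : Dom u) (g : Dom v) →
            Times t u v ⇔ _≈_ A (_*ₛ_ A (f t d) (f u e)) (f v g)
    cm-neg   : ∀ t u (d : Dom t) (e : Dom u) → Neg t u ⇔ _≈_ A (-ₛ_ A (f t d)) (f u e)
    cm-zero  : ∀ t (d : Dom t) → Zero t ⇔ _≈_ A (f t d) (0# A)
    cm-one   : ∀ t (d : Dom t) → One t ⇔ _≈_ A (f t d) (1# A)

-- A code with k parameters and dimension n; variable order in each
-- formula: the n-tuples first, then the parameters.
record Code (k n : ℕ) : Set where
  field
    dom        : Formula (n + k)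
    eq         : Formula (n + (n + k))
    plus times : Formula (n + (n + (n + k)))
    neg        : Formula (n + (n + k))
    zer one    : Formula (n + k)

interpret : ∀ {k n} → Code k n → (B : Str) → (Fin k → Carrier B) →
            Interp (Fin n → Carrier B)
interpret Γ B p = record
  { Dom   = λ u → Sat B (Code.dom Γ) (u V.++ p)
  ; Eq    = λ u v → Sat B (Code.eq Γ) (u V.++ (v V.++ p))
  ; Plus  = λ u v w → Sat B (Code.plus Γ) (u V.++ (v V.++ (w V.++ p)))
  ; Times = λ u v w → Sat B (Code.times Γ) (u V.++ (v V.++ (w V.++ p)))
  ; Neg   = λ u v → Sat B (Code.neg Γ) (u V.++ (v V.++ p))
  ; Zero  = λ u → Sat B (Code.zer Γ) (u V.++ p)
  ; One   = λ u → Sat B (Code.one Γ) (u V.++ p) }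

record RegInterp (A B : Str) : Set₁ where
  field
    k n      : ℕ
    code     : Code k n
    φ        : Formula k
    φ-nonempty : Σ (Fin k → Carrier B) (Sat B φ)
    coord    : (p : Fin k → Carrier B) → Sat B φ p →
               Σ ((u : Fin n → Carrier B) → Interp.Dom (interpret code B p) u → Carrier A)
                 (IsCoordMap (interpret code B p) A)

-- Satisfaction of ring formulas inside an interpreted structure I
-- (variables range over Dom, = is Eq, operations via their graphs);
-- this is the semantics of the relativised translation of formulas.

module _ {T : Set} (I : Interp T) where
  open Interp I

  EvalIn : ∀ {j} → Term j → (Fin j → T) → T → Set
  EvalIn (var i) ρ v = Eq (ρ i) v
  EvalIn (s ⊕ t) ρ v = Σ T λ a → Σ T λ b → Dom a × Dom b × EvalIn s ρ a × EvalIn t ρ b × Plus a b v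
  EvalIn (s ⊗ t) ρ v = Σ T λ a → Σ T λ b → Dom a × Dom b × EvalIn s ρ a × EvalIn t ρ b × Times a b v
  EvalIn (⊖ t)   ρ v = Σ T λ a → Dom a × EvalIn t ρ a × Neg a v
  EvalIn 𝟘       ρ v = Zero v
  EvalIn 𝟙       ρ v = One v

  SatIn : ∀ {j} → Formula j → (Fin j → T) → Set
  SatIn (s ≐ t)  ρ = Σ T λ v → Dom v × EvalIn s ρ v × EvalIn t ρ v
  SatIn ⊥f       ρ = ⊥
  SatIn (φ ∧f ψ) ρ = SatIn φ ρ × SatIn ψ ρ
  SatIn (φ ∨f ψ) ρ = SatIn φ ρ ⊎ SatIn ψ ρ
  SatIn (φ ⇒f ψ) ρ = SatIn φ ρ → SatIn ψ ρ
  SatIn (∀f φ)   ρ = (a : T) → Dom a → SatIn φ (a V.∷ ρ)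
  SatIn (∃f φ)   ρ = Σ T λ a → Dom a × SatIn φ (a V.∷ ρ)

  interpretIn : ∀ {k n} → Code k n → (Fin k → T) → Interp (Fin n → T)
  interpretIn Γ q = record
    { Dom   = λ u → ((i : Fin _) → Dom (u i)) × SatIn (Code.dom Γ) (u V.++ q)
    ; Eq    = λ u v → SatIn (Code.eq Γ) (u V.++ (v V.++ q))
    ; Plus  = λ u v w → SatIn (Code.plus Γ) (u V.++ (v V.++ (w V.++ q)))
    ; Times = λ u v w → SatIn (Code.times Γ) (u V.++ (v V.++ (w V.++ q)))
    ; Neg   = λ u v → SatIn (Code.neg Γ) (u V.++ (v V.++ q))
    ; Zero  = λ u → SatIn (Code.zer Γ) (u V.++ q)
    ; One   = λ u → SatIn (Code.one Γ) (u V.++ q) }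

flat : ∀ {n m} {X : Set} → (Fin n → Fin m → X) → Fin (n * m) → X
flat {n} {m} u i = uncurry u (remQuot m i)

-- Composite interpretation Γ ∘ Δ of A in A, where Γ interprets A in B and
-- Δ interprets B in A.  Parameters r̄₀ = (z̄, q̄): z̄ parameters of Δ,
-- q̄ a k_Γ-tuple of Δ-tuples representing parameters of Γ in Δ(A, z̄).

module Composite {A B : Str} (Γ : RegInterp A B) (Δ : RegInterp B A) where
  private
    module Γ = RegInterp Γ
    module Δ = RegInterp Δ

  ΔA : (Fin Δ.k → Carrier A) → Interp (Fin Δ.n → Carrier A)
  ΔA z = interpret Δ.code A z

  Admissible : (Fin Δ.k → Carrier A) → (Fin Γ.k → Fin Δ.n → Carrier A) → Set
  Admissible z q = Sat A Δ.φ z × ((i : Fin Γ.k) → Interp.Dom (ΔA z) (q i))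
                   × SatIn (ΔA z) Γ.φ q

  comp : (Fin Δ.k → Carrier A) → (Fin Γ.k → Fin Δ.n → Carrier A) →
         Interp (Fin Γ.n → Fin Δ.n → Carrier A)
  comp z q = interpretIn (ΔA z) Γ.code q

  Defines : Formula (Γ.n * Δ.n + suc (Δ.k + Γ.k * Δ.n)) →
            (Fin Δ.k → Carrier A) → (Fin Γ.k → Fin Δ.n → Carrier A) → Set
  Defines θ z q =
    Σ ((u : Fin Γ.n → Fin Δ.n → Carrier A) → Interp.Dom (comp z q) u → Carrier A) λ f →
      IsCoordMap (comp z q) A f ×
      (∀ u (d : Interp.Dom (comp z q) u) (x : Carrier A) →
         Sat A θ (flat u V.++ (x V.∷ (z V.++ flat q))) ⇔ _≈_ A x (f u d))

record RegBiInterp (A B : Str) : Set₁ where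
  field
    Γ : RegInterp A B
    Δ : RegInterp B A
  private
    module Γ = RegInterp Γ
    module Δ = RegInterp Δ
  field
    θA  : Formula (Γ.n * Δ.n + suc (Δ.k + Γ.k * Δ.n))
    θB  : Formula (Δ.n * Γ.n + suc (Γ.k + Δ.k * Γ.n))
    θA-ok : ∀ z q → Composite.Admissible Γ Δ z q → Composite.Defines Γ Δ θA z q
    θB-ok : ∀ z q → Composite.Admissible Δ Γ z q → Composite.Defines Δ Γ θB z q

{-# OPTIONS --safe #-}
-- ℤ[x] is coded in ℤ by finite sequences (a variant of Gödel's β that does not mention the order),
-- a code being identified with its values U(c) at all integers c; these are definable by Horner's scheme,
-- and two polynomials, or a polynomial and a sum or product, agree as soon as all their values do.
-- ℤ is definable in ℤ[x] through the Pell equations X² − (u² − 1) Y² = 1, whose solutions satisfy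
-- Y ≡ n modulo u − 1 with n an integer.  A parameter a ∈ ℤ[x] such that U ↦ U(a) is bijective gives the
-- coordinate map of the composite on ℤ[x]: y = U(a) if and only if a − c divides y − U(c) for every integer c.
module Submission where

open import Defs
open import Data.Fin using (Fin; zero; suc; splitAt; _↑ʳ_)
open import Data.Fin.Patterns
open import Data.Integer using (ℤ; _+_; _*_; -_; 0ℤ; 1ℤ; ∣_∣; -[1+_]) renaming (+_ to pos)
import Data.Integer.Divisibility.Signed as ℤ
import Data.Integer.Properties as ℤ
open import Data.Integer.Tactic.RingSolver using (solve-∀)
open import Data.List using (List; []; _∷_; map; length)
open import Data.Nat as ℕ using (ℕ; zero; suc; s≤s; z≤n; _^_; _!)
import Data.Nat.Divisibility as ℕ
open import Data.Nat.Induction using (<-rec)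
open import Data.Nat.Primality using (prime[2]; euclidsLemma)
import Data.Nat.Properties as ℕ
open import Data.Product as Product using (Σ; ∃; _×_; _,_; proj₁; proj₂)
open import Data.Sum as Sum using (_⊎_; inj₁; inj₂)
open import Data.Unit using (⊤; tt)
open import Data.Vec.Functional as V using ()
open import Function.Bundles using (_⇔_; mk⇔; Equivalence)
open import Function.Construct.Composition using (_⇔-∘_)
open import Function.Construct.Symmetry using (⇔-sym)
open import Relation.Binary.PropositionalEquality
open import Relation.Binary.Structures using (IsEquivalence)
open import Relation.Nullary using (yes; no; contradiction)
open import Relation.Nullary.Decidable using (from-no)

open ≡-Reasoning
open Equivalence using (to; from)

-- Coordinate maps and satisfaction in an interpreted structure

-- The automorphism x ↦ x + 1 of ℤ[x] fixes every integer, and the composite on ℤ[x] consists of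
-- triples of integers, so without a parameter no formula can tell which polynomial a triple stands
-- for. The parameter `a` takes the place of x. Regularity demands that every admissible `a` works,
-- hence admissibility has to be expressed by a formula: U ↦ U(a) is then an automorphism, and
-- composing with it is a harmless change of coordinates. The integer n attached to a Pell solution
-- is, up to sign, the exponent of the unit u + √(u² - 1). Satisfaction is constructive, so each
-- equivalence has to deliver its witnesses; decoding, for instance, reads a list off the proof that
-- the domain formula holds.

record IsCongruent (S : Str) : Set where
  open Str S
  field
    ≈-isEquivalence : IsEquivalence _≈_
    +-cong : ∀ {a b c d} → a ≈ b → c ≈ d → (a +ₛ c) ≈ (b +ₛ d)
    *-cong : ∀ {a b c d} → a ≈ b → c ≈ d → (a *ₛ c) ≈ (b *ₛ d)
    neg-cong : ∀ {a b} → a ≈ b → (-ₛ a) ≈ (-ₛ b)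
  open IsEquivalence ≈-isEquivalence public renaming (refl to ≈-refl; sym to ≈-sym; trans to ≈-trans)

module Reduction {B : Str} (B-cong : IsCongruent B) {T : Set} {I : Interp T}
                 {f : (t : T) → Interp.Dom I t → Str.Carrier B} (cm : IsCoordMap I B f) where
  open Str B
  open IsCongruent B-cong
  open Interp I
  open IsCoordMap cm

  _≙_ : T → Carrier → Set
  t ≙ b = Σ (Dom t) λ d → f t d ≈ b

  -- Compound terms are read through graphs, so the values of subterms must be named by elements of
  -- the domain; surjectivity of `f` supplies them.
  evalIn⇔ : ∀ {j} (s : Term j) {ρ σ} → (∀ i → ρ i ≙ σ i) → ∀ {v} (d : Dom v) →
            EvalIn I s ρ v ⇔ (evalT B s σ ≈ f v d)
  evalIn⇔ (var i) {ρ} R {v} d =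
    mk⇔ (λ e → ≈-trans (≈-sym (proj₂ (R i))) (to (cm-eq _ _ (proj₁ (R i)) d) e))
        (λ e → from (cm-eq _ _ (proj₁ (R i)) d) (≈-trans (proj₂ (R i)) e))
  evalIn⇔ (s ⊕ t) R {v} d = mk⇔
    (λ (a , b , da , db , ea , eb , e) →
      ≈-trans (+-cong (to (evalIn⇔ s R da) ea) (to (evalIn⇔ t R db) eb)) (to (cm-plus a b v da db d) e))
    (λ e → let a , da , ea = cm-surj (evalT B s _) ; b , db , eb = cm-surj (evalT B t _) in
      a , b , da , db , from (evalIn⇔ s R da) (≈-sym ea) , from (evalIn⇔ t R db) (≈-sym eb) ,
      from (cm-plus a b v da db d) (≈-trans (+-cong ea eb) e))
  evalIn⇔ (s ⊗ t) R {v} d = mk⇔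
    (λ (a , b , da , db , ea , eb , e) →
      ≈-trans (*-cong (to (evalIn⇔ s R da) ea) (to (evalIn⇔ t R db) eb)) (to (cm-times a b v da db d) e))
    (λ e → let a , da , ea = cm-surj (evalT B s _) ; b , db , eb = cm-surj (evalT B t _) in
      a , b , da , db , from (evalIn⇔ s R da) (≈-sym ea) , from (evalIn⇔ t R db) (≈-sym eb) ,
      from (cm-times a b v da db d) (≈-trans (*-cong ea eb) e))
  evalIn⇔ (⊖ t) R {v} d = mk⇔
    (λ (a , da , ea , e) → ≈-trans (neg-cong (to (evalIn⇔ t R da) ea)) (to (cm-neg a v da d) e))
    (λ e → let a , da , ea = cm-surj (evalT B t _) in
      a , da , from (evalIn⇔ t R da) (≈-sym ea) , from (cm-neg a v da d) (≈-trans (neg-cong ea) e))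
  evalIn⇔ 𝟘 R d = mk⇔ (λ e → ≈-sym (to (cm-zero _ d) e)) (λ e → from (cm-zero _ d) (≈-sym e))
  evalIn⇔ 𝟙 R d = mk⇔ (λ e → ≈-sym (to (cm-one _ d) e)) (λ e → from (cm-one _ d) (≈-sym e))

  ≙-∷ : ∀ {j} {ρ : Fin j → T} {σ : Fin j → Carrier} {t b} → t ≙ b → (∀ i → ρ i ≙ σ i) →
        ∀ i → (t V.∷ ρ) i ≙ (b V.∷ σ) i
  ≙-∷ r R zero    = r
  ≙-∷ r R (suc i) = R i

  ≙-++ : ∀ {m j} {ρ : Fin m → T} {σ : Fin m → Carrier} {ρ′ : Fin j → T} {σ′ : Fin j → Carrier} →
         (∀ i → ρ i ≙ σ i) → (∀ i → ρ′ i ≙ σ′ i) → ∀ i → (ρ V.++ ρ′) i ≙ (σ V.++ σ′) i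
  ≙-++ {m} R R′ i with splitAt m i
  ... | inj₁ k = R k
  ... | inj₂ k = R′ k

  abstract
    -- Surjectivity turns quantifiers over the domain into quantifiers over `B`. Relating the
    -- assignments only up to `≈` leaves the choice of preimages free.
    satIn⇔ : ∀ {j} (φ : Formula j) {ρ σ} → (∀ i → ρ i ≙ σ i) → SatIn I φ ρ ⇔ Sat B φ σ
    satIn⇔ (s ≐ t) R = mk⇔
      (λ (v , d , e₁ , e₂) → ≈-trans (to (evalIn⇔ s R d) e₁) (≈-sym (to (evalIn⇔ t R d) e₂)))
      (λ e → let v , d , ev = cm-surj (evalT B s _) in
        v , d , from (evalIn⇔ s R d) (≈-sym ev) , from (evalIn⇔ t R d) (≈-trans (≈-sym e) (≈-sym ev)))
    satIn⇔ ⊥f       R = mk⇔ (λ ()) (λ ())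
    satIn⇔ (φ ∧f ψ) R = mk⇔ (Product.map (to (satIn⇔ φ R)) (to (satIn⇔ ψ R)))
                            (Product.map (from (satIn⇔ φ R)) (from (satIn⇔ ψ R)))
    satIn⇔ (φ ∨f ψ) R = mk⇔ (Sum.map (to (satIn⇔ φ R)) (to (satIn⇔ ψ R)))
                            (Sum.map (from (satIn⇔ φ R)) (from (satIn⇔ ψ R)))
    satIn⇔ (φ ⇒f ψ) R = mk⇔ (λ h x → to (satIn⇔ ψ R) (h (from (satIn⇔ φ R) x)))
                            (λ h x → from (satIn⇔ ψ R) (h (to (satIn⇔ φ R) x)))
    satIn⇔ (∀f φ)   R = mk⇔
      (λ h b → let t , r = cm-surj b in to (satIn⇔ φ (≙-∷ r R)) (h t (proj₁ r)))
      (λ h t d → from (satIn⇔ φ (≙-∷ (d , ≈-refl) R)) (h (f t d)))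
    satIn⇔ (∃f φ)   R = mk⇔
      (λ (t , d , s) → f t d , to (satIn⇔ φ (≙-∷ (d , ≈-refl) R)) s)
      (λ (b , s) → let t , r = cm-surj b in t , proj₁ r , from (satIn⇔ φ (≙-∷ r R)) s)

  module Composition {A : Str} (A-cong : IsCongruent A) {k n : ℕ} (code : Code k n) {q : Fin k → T} {p : Fin k → Carrier}
           (Q : ∀ i → q i ≙ p i)
           {g : (u : Fin n → Carrier) → Interp.Dom (interpret code B p) u → Str.Carrier A}
           (cmg : IsCoordMap (interpret code B p) A g) where
    private
      module A = IsCongruent A-cong
      module G = IsCoordMap cmg
      module C = Interp (interpretIn I code q)

    coordinates : (u : Fin n → T) → C.Dom u → Fin n → Carrier
    coordinates u (d , _) i = f (u i) (d i)

    private
      related : ∀ u (d : C.Dom u) i → u i ≙ coordinates u d i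
      related u (d , _) i = d i , ≈-refl

    dom : ∀ u (d : C.Dom u) → Interp.Dom (interpret code B p) (coordinates u d)
    dom u d = to (satIn⇔ (Code.dom code) (≙-++ (related u d) Q)) (proj₂ d)

    compose : (u : Fin n → T) → C.Dom u → Str.Carrier A
    compose u d = g (coordinates u d) (dom u d)

    isCoordMap-compose : IsCoordMap (interpretIn I code q) A compose
    isCoordMap-compose = record
      { cm-surj = λ a →
          let t , d , e = G.cm-surj a
              u i = proj₁ (cm-surj (t i))
              R i = proj₂ (cm-surj (t i))
              du = (λ i → proj₁ (R i)) , from (satIn⇔ (Code.dom code) (≙-++ R Q)) d
              -- The coordinates of the chosen preimages agree with `t` only up to `≈`. Both tuples
              -- are represented by `u`, so the relation of `t` to itself transfers to the pair.
              eq = to (satIn⇔ (Code.eq code) (≙-++ (related u du) (≙-++ R Q)))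
                     (from (satIn⇔ (Code.eq code) (≙-++ R (≙-++ R Q)))
                       (from (G.cm-eq t t d d) A.≈-refl))
          in u , du , A.≈-trans (to (G.cm-eq _ t (dom u du) d) eq) e
      ; cm-eq = λ t u d e → G.cm-eq _ _ (dom t d) (dom u e) ⇔-∘
          satIn⇔ (Code.eq code) (≙-++ (related t d) (≙-++ (related u e) Q))
      ; cm-plus = λ t u v d e h → G.cm-plus _ _ _ (dom t d) (dom u e) (dom v h) ⇔-∘
          satIn⇔ (Code.plus code) (≙-++ (related t d) (≙-++ (related u e) (≙-++ (related v h) Q)))
      ; cm-times = λ t u v d e h → G.cm-times _ _ _ (dom t d) (dom u e) (dom v h) ⇔-∘
          satIn⇔ (Code.times code) (≙-++ (related t d) (≙-++ (related u e) (≙-++ (related v h) Q)))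
      ; cm-neg = λ t u d e → G.cm-neg _ _ (dom t d) (dom u e) ⇔-∘
          satIn⇔ (Code.neg code) (≙-++ (related t d) (≙-++ (related u e) Q))
      ; cm-zero = λ t d → G.cm-zero _ (dom t d) ⇔-∘ satIn⇔ (Code.zer code) (≙-++ (related t d) Q)
      ; cm-one = λ t d → G.cm-one _ (dom t d) ⇔-∘ satIn⇔ (Code.one code) (≙-++ (related t d) Q)
      }

-- Integer polynomials, their values and degrees

infix 4 _≋_
_≋_ : List ℤ → List ℤ → Set
_≋_ = Str._≈_ ℤ[x]-Str

eval : List ℤ → ℤ → ℤ
eval []      c = 0ℤ
eval (a ∷ p) c = a + c * eval p c

eval-padd : ∀ p q c → eval (padd p q) c ≡ eval p c + eval q c
eval-padd []      q       c = sym (ℤ.+-identityˡ _)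
eval-padd (a ∷ p) []      c = sym (ℤ.+-identityʳ _)
eval-padd (a ∷ p) (b ∷ q) c rewrite eval-padd p q c = lemma a b c (eval p c) (eval q c)
  where
  lemma : ∀ a b c x y → (a + b) + c * (x + y) ≡ (a + c * x) + (b + c * y)
  lemma = solve-∀

eval-pneg : ∀ p c → eval (pneg p) c ≡ - eval p c
eval-pneg []      c = refl
eval-pneg (a ∷ p) c rewrite eval-pneg p c = lemma a c (eval p c)
  where
  lemma : ∀ a c x → - a + c * (- x) ≡ - (a + c * x)
  lemma = solve-∀

eval-scale : ∀ a p c → eval (map (a *_) p) c ≡ a * eval p c
eval-scale a []      c = sym (ℤ.*-zeroʳ a)
eval-scale a (b ∷ p) c rewrite eval-scale a p c = lemma a b c (eval p c)
  where
  lemma : ∀ a b c x → a * b + c * (a * x) ≡ a * (b + c * x)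
  lemma = solve-∀

eval-pmul : ∀ p q c → eval (pmul p q) c ≡ eval p c * eval q c
eval-pmul []      q c = refl
eval-pmul (a ∷ p) q c
  rewrite eval-padd (map (a *_) q) (0ℤ ∷ pmul p q) c | eval-scale a q c | eval-pmul p q c
  = lemma a c (eval p c) (eval q c)
  where
  lemma : ∀ a c x y → a * y + (0ℤ + c * (x * y)) ≡ (a + c * x) * y
  lemma = solve-∀

coeff-padd : ∀ p q i → coeff (padd p q) i ≡ coeff p i + coeff q i
coeff-padd []      q       i       = sym (ℤ.+-identityˡ _)
coeff-padd (a ∷ p) []      i       = sym (ℤ.+-identityʳ _)
coeff-padd (a ∷ p) (b ∷ q) zero    = refl
coeff-padd (a ∷ p) (b ∷ q) (suc i) = coeff-padd p q i

coeff-pneg : ∀ p i → coeff (pneg p) i ≡ - coeff p i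
coeff-pneg []      i       = refl
coeff-pneg (a ∷ p) zero    = refl
coeff-pneg (a ∷ p) (suc i) = coeff-pneg p i

coeff-scale : ∀ a p i → coeff (map (a *_) p) i ≡ a * coeff p i
coeff-scale a []      i       = sym (ℤ.*-zeroʳ a)
coeff-scale a (b ∷ p) zero    = refl
coeff-scale a (b ∷ p) (suc i) = coeff-scale a p i

eval-≋[] : ∀ p → p ≋ [] → ∀ c → eval p c ≡ 0ℤ
eval-≋[] []      h c = refl
eval-≋[] (a ∷ p) h c rewrite h 0 | eval-≋[] p (λ i → h (suc i)) c = trans (ℤ.+-identityˡ _) (ℤ.*-zeroʳ c)

eval-cong : ∀ p q → p ≋ q → ∀ c → eval p c ≡ eval q c
eval-cong p       []      h c = eval-≋[] p h c
eval-cong []      (b ∷ q) h c = sym (eval-≋[] (b ∷ q) (λ i → sym (h i)) c)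
eval-cong (a ∷ p) (b ∷ q) h c = cong₂ (λ a x → a + c * x) (h 0) (eval-cong p q (λ i → h (suc i)) c)

*-cancelˡ-zero : ∀ c {x} → c ≢ 0ℤ → c * x ≡ 0ℤ → x ≡ 0ℤ
*-cancelˡ-zero c c≢0 e with ℤ.i*j≡0⇒i≡0∨j≡0 c e
... | inj₁ c≡0 = contradiction c≡0 c≢0
... | inj₂ x≡0 = x≡0

∣∣-small⇒≡0 : ∀ a m x → ∣ a ∣ ℕ.< ∣ m ∣ → a ≡ m * x → a ≡ 0ℤ
∣∣-small⇒≡0 a m x a<m e = by-cases ∣ x ∣ refl
  where
  by-cases : ∀ k → ∣ x ∣ ≡ k → a ≡ 0ℤ
  by-cases zero    eq = trans e (trans (cong (m *_) (ℤ.∣i∣≡0⇒i≡0 eq)) (ℤ.*-zeroʳ m))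
  by-cases (suc k) eq = contradiction a<m (ℕ.≤⇒≯ (subst (∣ m ∣ ℕ.≤_) (sym ∣a∣) (ℕ.m≤m*n ∣ m ∣ (suc k))))
    where
    ∣a∣ : ∣ a ∣ ≡ ∣ m ∣ ℕ.* suc k
    ∣a∣ = trans (cong ∣_∣ e) (trans (ℤ.abs-* m x) (cong (∣ m ∣ ℕ.*_) eq))

-- Zero is excluded so that the vanishing passes from a + c p(c) to p(c).
eval-zero⇒≋[] : ∀ p → (∀ c → c ≢ 0ℤ → eval p c ≡ 0ℤ) → p ≋ []
eval-zero⇒≋[] []      h i = refl
eval-zero⇒≋[] (a ∷ p) h = λ { zero → a≡0 ; (suc i) → eval-zero⇒≋[] p h′ i }
  where
  -- A nonzero point larger than a in absolute value: it divides a because a + m p(m) = 0, so a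
  -- vanishes.
  m : ℤ
  m = pos (suc ∣ a ∣)

  solveFor : ∀ a c x → a ≡ (a + c * x) + c * (- x)
  solveFor = solve-∀

  a≡0 : a ≡ 0ℤ
  a≡0 = ∣∣-small⇒≡0 a m (- eval p m) ℕ.≤-refl
          (trans (solveFor a m (eval p m))
            (trans (cong (_+ m * (- eval p m)) (h m λ ())) (ℤ.+-identityˡ _)))

  h′ : ∀ c → c ≢ 0ℤ → eval p c ≡ 0ℤ
  h′ c c≢0 = *-cancelˡ-zero c c≢0
    (trans (sym (ℤ.+-identityˡ _)) (trans (cong (_+ c * eval p c) (sym a≡0)) (h c c≢0)))

eval-ext : ∀ p q → (∀ c → eval p c ≡ eval q c) → p ≋ q
eval-ext p q h i = ℤ.i-j≡0⇒i≡j (coeff p i) (coeff q i) (begin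
    coeff p i + - coeff q i       ≡⟨ cong (coeff p i +_) (coeff-pneg q i) ⟨
    coeff p i + coeff (pneg q) i  ≡⟨ coeff-padd p (pneg q) i ⟨
    coeff (padd p (pneg q)) i     ≡⟨ eval-zero⇒≋[] (padd p (pneg q)) (λ c _ → zeros c) i ⟩
    0ℤ                            ∎)
  where
  zeros : ∀ c → eval (padd p (pneg q)) c ≡ 0ℤ
  zeros c = begin
    eval (padd p (pneg q)) c       ≡⟨ eval-padd p (pneg q) c ⟩
    eval p c + eval (pneg q) c     ≡⟨ cong₂ _+_ (h c) (eval-pneg q c) ⟩
    eval q c + - eval q c          ≡⟨ ℤ.i≡j⇒i-j≡0 {eval q c} refl ⟩
    0ℤ                             ∎

ℤ[x]-isCongruent : IsCongruent ℤ[x]-Str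
ℤ[x]-isCongruent = record
  { ≈-isEquivalence = record { refl = λ i → refl ; sym = λ h i → sym (h i) ; trans = λ h k i → trans (h i) (k i) }
  ; +-cong = λ {a} {b} {c} {d} h k → eval-ext (padd a c) (padd b d) λ x → trans (eval-padd a c x)
      (trans (cong₂ _+_ (eval-cong a b h x) (eval-cong c d k x)) (sym (eval-padd b d x)))
  ; *-cong = λ {a} {b} {c} {d} h k → eval-ext (pmul a c) (pmul b d) λ x → trans (eval-pmul a c x)
      (trans (cong₂ _*_ (eval-cong a b h x) (eval-cong c d k x)) (sym (eval-pmul b d x)))
  ; neg-cong = λ {a} {b} h → eval-ext (pneg a) (pneg b) λ x → trans (eval-pneg a x)
      (trans (cong (λ a → - a) (eval-cong a b h x)) (sym (eval-pneg b x)))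
  }

ℤ-isCongruent : IsCongruent ℤ-Str
ℤ-isCongruent = record
  { ≈-isEquivalence = isEquivalence ; +-cong = cong₂ _+_ ; *-cong = cong₂ _*_ ; neg-cong = cong (λ a → - a) }

eval-evalT : ∀ {n} (t : Term n) ρ c → eval (evalT ℤ[x]-Str t ρ) c ≡ evalT ℤ-Str t (λ i → eval (ρ i) c)
eval-evalT (var i) ρ c = refl
eval-evalT (s ⊕ t) ρ c = trans (eval-padd (evalT ℤ[x]-Str s ρ) _ c) (cong₂ _+_ (eval-evalT s ρ c) (eval-evalT t ρ c))
eval-evalT (s ⊗ t) ρ c = trans (eval-pmul (evalT ℤ[x]-Str s ρ) _ c) (cong₂ _*_ (eval-evalT s ρ c) (eval-evalT t ρ c))
eval-evalT (⊖ t)   ρ c = trans (eval-pneg (evalT ℤ[x]-Str t ρ) c) (cong (λ a → - a) (eval-evalT t ρ c))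
eval-evalT 𝟘       ρ c = refl
eval-evalT 𝟙       ρ c = cong (1ℤ +_) (ℤ.*-zeroʳ c)

-- degree p < d
Below : List ℤ → ℕ → Set
Below p d = ∀ i → d ℕ.≤ i → coeff p i ≡ 0ℤ

HasDegree : List ℤ → ℕ → Set
HasDegree p d = coeff p d ≢ 0ℤ × Below p (suc d)

degree : ∀ p → p ≋ [] ⊎ ∃ (HasDegree p)
degree [] = inj₁ λ i → refl
degree (a ∷ p) with degree p
... | inj₂ (d , l , b) = inj₂ (suc d , l , λ { (suc i) (s≤s d≤i) → b i d≤i })
... | inj₁ z with a ℤ.≟ 0ℤ
...   | yes a≡0 = inj₁ λ { zero → a≡0 ; (suc i) → z i }
...   | no  a≢0 = inj₂ (0 , a≢0 , λ { (suc i) _ → z i })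

-- The bound on p is strict (degree < m) and the one on q is not (degree ≤ e), which makes m + e
-- sharp and includes p = 0. A vanishing p may be a list of zeros, hence the detour through values.
Below-pmul : ∀ p q m e → Below p m → Below q (suc e) → Below (pmul p q) (m ℕ.+ e)
Below-pmul p q zero e P Q i _ =
  eval-ext (pmul p q) [] (λ c → trans (eval-pmul p q c) (cong (_* eval q c) (eval-≋[] p (λ i → P i z≤n) c))) i
Below-pmul []      q (suc m) e P Q i       le = refl
Below-pmul (a ∷ p) q (suc m) e P Q (suc i) (s≤s le) = begin
  coeff (padd (map (a *_) q) (0ℤ ∷ pmul p q)) (suc i) ≡⟨ coeff-padd (map (a *_) q) _ (suc i) ⟩
  coeff (map (a *_) q) (suc i) + coeff (pmul p q) i   ≡⟨ cong₂ _+_ (coeff-scale a q (suc i))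
                                                          (Below-pmul p q m e (λ i l → P (suc i) (s≤s l)) Q i le) ⟩
  a * coeff q (suc i) + 0ℤ                            ≡⟨ ℤ.+-identityʳ _ ⟩
  a * coeff q (suc i)                                 ≡⟨ cong (a *_) (Q (suc i) (s≤s (ℕ.≤-trans (ℕ.m≤n+m e m) le))) ⟩
  a * 0ℤ                                              ≡⟨ ℤ.*-zeroʳ a ⟩
  0ℤ                                                  ∎

leading-pmul : ∀ p q d e → Below p (suc d) → Below q (suc e) →
               coeff (pmul p q) (d ℕ.+ e) ≡ coeff p d * coeff q e
leading-pmul []      q d e P Q = refl
leading-pmul (a ∷ p) q zero zero P Q = begin
  coeff (padd (map (a *_) q) (0ℤ ∷ pmul p q)) 0 ≡⟨ coeff-padd (map (a *_) q) _ 0 ⟩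
  coeff (map (a *_) q) 0 + 0ℤ                   ≡⟨ ℤ.+-identityʳ _ ⟩
  coeff (map (a *_) q) 0                        ≡⟨ coeff-scale a q 0 ⟩
  a * coeff q 0                                 ∎
leading-pmul (a ∷ p) q zero (suc e) P Q = begin
  coeff (padd (map (a *_) q) (0ℤ ∷ pmul p q)) (suc e) ≡⟨ coeff-padd (map (a *_) q) _ (suc e) ⟩
  coeff (map (a *_) q) (suc e) + coeff (pmul p q) e   ≡⟨ cong (coeff (map (a *_) q) (suc e) +_) vanish ⟩
  coeff (map (a *_) q) (suc e) + 0ℤ                   ≡⟨ ℤ.+-identityʳ _ ⟩
  coeff (map (a *_) q) (suc e)                        ≡⟨ coeff-scale a q (suc e) ⟩
  a * coeff q (suc e)                                 ∎
  where
  vanish : coeff (pmul p q) e ≡ 0ℤ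
  vanish = eval-ext (pmul p q) []
    (λ c → trans (eval-pmul p q c) (cong (_* eval q c) (eval-≋[] p (λ i → P (suc i) (s≤s z≤n)) c))) e
leading-pmul (a ∷ p) q (suc d) e P Q = begin
  coeff (padd (map (a *_) q) (0ℤ ∷ pmul p q)) (suc (d ℕ.+ e))       ≡⟨ coeff-padd (map (a *_) q) _ (suc (d ℕ.+ e)) ⟩
  coeff (map (a *_) q) (suc (d ℕ.+ e)) + coeff (pmul p q) (d ℕ.+ e) ≡⟨ cong₂ _+_ (coeff-scale a q (suc (d ℕ.+ e)))
                                                                        (leading-pmul p q d e (λ i l → P (suc i) (s≤s l)) Q) ⟩
  a * coeff q (suc (d ℕ.+ e)) + coeff p d * coeff q e
    ≡⟨ cong (λ z → a * z + coeff p d * coeff q e) (Q (suc (d ℕ.+ e)) (s≤s (ℕ.m≤n+m e d))) ⟩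
  a * 0ℤ + coeff p d * coeff q e                                    ≡⟨ cong (_+ _) (ℤ.*-zeroʳ a) ⟩
  0ℤ + coeff p d * coeff q e                                        ≡⟨ ℤ.+-identityˡ _ ⟩
  coeff p d * coeff q e                                             ∎

HasDegree-pmul : ∀ {p q d e} → HasDegree p d → HasDegree q e → HasDegree (pmul p q) (d ℕ.+ e)
HasDegree-pmul {p} {q} {d} {e} (l , P) (m , Q) =
  (λ z → m (*-cancelˡ-zero (coeff p d) l (trans (sym (leading-pmul p q d e P Q)) z))) ,
  Below-pmul p q (suc d) e P Q

-- The Pell equation and the definition of ℤ in ℤ[x]

weaken : ∀ {n} → Term n → Term (suc n)
weaken (var i) = var (suc i)
weaken (s ⊕ t) = weaken s ⊕ weaken t
weaken (s ⊗ t) = weaken s ⊗ weaken t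
weaken (⊖ t)   = ⊖ weaken t
weaken 𝟘       = 𝟘
weaken 𝟙       = 𝟙

dvd : ∀ {n} → Term n → Term n → Formula n
dvd s t = ∃f ((weaken s ⊗ var 0F) ≐ weaken t)

pellRHS : ∀ {n} → Term n → Term n → Term n
pellRHS u y = (((u ⊗ u) ⊕ (⊖ 𝟙)) ⊗ (y ⊗ y)) ⊕ 𝟙

-- The Pell equation X² = (u² − 1) Y² + 1 has a solution with Y ≡ n modulo u − 1 for every integer n,
-- and if u is not constant then each of its solutions has Y congruent to an integer.
-- A non-constant polynomial is not congruent to an integer modulo u − 1 once u has larger degree.
isInteger : ∀ {n} → Fin n → Formula n
isInteger i = ∀f (∃f (∃f (((var 1F ⊗ var 1F) ≐ pellRHS (var 2F) (var 0F)) ∧f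
                          dvd (var 2F ⊕ (⊖ 𝟙)) (var 0F ⊕ (⊖ var (suc (suc (suc i))))))))

values : ∀ {n} → (Fin n → List ℤ) → ℤ → Fin n → ℤ
values ρ c i = eval (ρ i) c

≋-pointwise : ∀ {n} (s t : Term n) ρ → evalT ℤ[x]-Str s ρ ≋ evalT ℤ[x]-Str t ρ →
              ∀ c → evalT ℤ-Str s (values ρ c) ≡ evalT ℤ-Str t (values ρ c)
≋-pointwise s t ρ h c =
  trans (sym (eval-evalT s ρ c)) (trans (eval-cong (evalT ℤ[x]-Str s ρ) (evalT ℤ[x]-Str t ρ) h c) (eval-evalT t ρ c))

pointwise-≋ : ∀ {n} (s t : Term n) ρ →
              (∀ c → evalT ℤ-Str s (values ρ c) ≡ evalT ℤ-Str t (values ρ c)) →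
              evalT ℤ[x]-Str s ρ ≋ evalT ℤ[x]-Str t ρ
pointwise-≋ s t ρ h = eval-ext (evalT ℤ[x]-Str s ρ) (evalT ℤ[x]-Str t ρ)
  λ c → trans (eval-evalT s ρ c) (trans (h c) (sym (eval-evalT t ρ c)))

const : ℤ → List ℤ
const n = n ∷ []

eval-const : ∀ n c → eval (const n) c ≡ n
eval-const n c = trans (cong (n +_) (ℤ.*-zeroʳ c)) (ℤ.+-identityʳ n)

IsPell : List ℤ → List ℤ → List ℤ → Set
IsPell u X Y = ∀ c → eval X c * eval X c ≡ (eval u c * eval u c + - 1ℤ) * (eval Y c * eval Y c) + 1ℤ

neg-IsPell : ∀ u X Y → IsPell u X Y → IsPell u X (pneg Y)
neg-IsPell u X Y h c rewrite eval-pneg Y c = trans (h c) (lemma (eval u c) (eval Y c))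
  where
  lemma : ∀ u y → (u * u + - 1ℤ) * (y * y) + 1ℤ ≡ (u * u + - 1ℤ) * ((- y) * (- y)) + 1ℤ
  lemma = solve-∀

-- The solution (X + Y √(u² − 1)) (u + √(u² − 1)).
raiseX raiseY : List ℤ → List ℤ → List ℤ → List ℤ
raiseX u X Y = padd (pmul u X) (pmul (padd (pmul u u) (pneg (const 1ℤ))) Y)
raiseY u X Y = padd X (pmul u Y)

eval-raiseX : ∀ u X Y c → eval (raiseX u X Y) c ≡ eval u c * eval X c + (eval u c * eval u c + - 1ℤ) * eval Y c
eval-raiseX u X Y = eval-evalT ((var 0F ⊗ var 1F) ⊕ (((var 0F ⊗ var 0F) ⊕ (⊖ 𝟙)) ⊗ var 2F)) (u V.∷ X V.∷ Y V.∷ V.[])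

eval-raiseY : ∀ u X Y c → eval (raiseY u X Y) c ≡ eval X c + eval u c * eval Y c
eval-raiseY u X Y = eval-evalT (var 1F ⊕ (var 0F ⊗ var 2F)) (u V.∷ X V.∷ Y V.∷ V.[])

-- The norm X² - (u² - 1) Y² is multiplicative, and u + √(u² - 1) has norm 1.
raise-IsPell : ∀ u X Y → IsPell u X Y → IsPell u (raiseX u X Y) (raiseY u X Y)
raise-IsPell u X Y h c rewrite eval-raiseX u X Y c | eval-raiseY u X Y c =
  trans (expand (eval u c) (eval X c) (eval Y c))
    (trans (cong (λ z → rest (eval u c) (eval X c) (eval Y c) + z) (h c))
           (collect (eval u c) (eval X c) (eval Y c)))
  where
  -- Splitting off x² makes a place where the equation of the given solution can be inserted; a
  -- polynomial identity remains.
  rest : ℤ → ℤ → ℤ → ℤ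
  rest u x y = (u * x + (u * u + - 1ℤ) * y) * (u * x + (u * u + - 1ℤ) * y) + - (x * x)
  expand : ∀ u x y → (u * x + (u * u + - 1ℤ) * y) * (u * x + (u * u + - 1ℤ) * y) ≡
    ((u * x + (u * u + - 1ℤ) * y) * (u * x + (u * u + - 1ℤ) * y) + - (x * x)) + x * x
  expand = solve-∀
  collect : ∀ u x y →
    ((u * x + (u * u + - 1ℤ) * y) * (u * x + (u * u + - 1ℤ) * y) + - (x * x)) + ((u * u + - 1ℤ) * (y * y) + 1ℤ) ≡
    (u * u + - 1ℤ) * ((x + u * y) * (x + u * y)) + 1ℤ
  collect = solve-∀

record Cong (u p : List ℤ) (ε : ℤ) : Set where
  constructor mod
  field
    quotient : List ℤ
    proof    : ∀ c → eval p c ≡ ε + (eval u c + - 1ℤ) * eval quotient c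

neg-Cong : ∀ u p ε → Cong u p ε → Cong u (pneg p) (- ε)
neg-Cong u p ε (mod q h) = mod (pneg q) proof
  where
  lemma : ∀ u q ε → - (ε + (u + - 1ℤ) * q) ≡ - ε + (u + - 1ℤ) * (- q)
  lemma = solve-∀
  proof : ∀ c → eval (pneg p) c ≡ - ε + (eval u c + - 1ℤ) * eval (pneg q) c
  proof c rewrite eval-pneg p c | eval-pneg q c | h c = lemma (eval u c) (eval q c) ε

-- Modulo u - 1 one has u = 1 and u² - 1 = 0, so a step sends (X, Y) to (X, X + Y): X keeps its
-- residue and Y grows by it.
raiseX-Cong : ∀ u X Y {ε n} → Cong u X ε → Cong u Y n → Cong u (raiseX u X Y) ε
raiseX-Cong u X Y {ε} (mod q hq) _ = mod (evalT ℤ[x]-Str t ρ) proof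
  where
  ρ : Fin 4 → List ℤ
  ρ = u V.∷ q V.∷ const ε V.∷ Y V.∷ V.[]
  t : Term 4
  t = (var 2F ⊕ (var 0F ⊗ var 1F)) ⊕ ((var 0F ⊕ 𝟙) ⊗ var 3F)
  lemma : ∀ u q ε y → u * (ε + (u + - 1ℤ) * q) + (u * u + - 1ℤ) * y ≡
                      ε + (u + - 1ℤ) * ((ε + u * q) + (u + 1ℤ) * y)
  lemma = solve-∀
  proof : ∀ c → eval (raiseX u X Y) c ≡ ε + (eval u c + - 1ℤ) * eval (evalT ℤ[x]-Str t ρ) c
  proof c rewrite eval-raiseX u X Y c | hq c | eval-evalT t ρ c | eval-const ε c =
    lemma (eval u c) (eval q c) ε (eval Y c)

raiseY-Cong : ∀ u X Y {ε n} → Cong u X ε → Cong u Y n → Cong u (raiseY u X Y) (ε + n)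
raiseY-Cong u X Y {ε} {n} (mod q hq) (mod r hr) = mod (evalT ℤ[x]-Str t ρ) proof
  where
  ρ : Fin 4 → List ℤ
  ρ = u V.∷ q V.∷ const n V.∷ r V.∷ V.[]
  t : Term 4
  t = (var 1F ⊕ var 2F) ⊕ (var 0F ⊗ var 3F)
  lemma : ∀ u q r ε n → (ε + (u + - 1ℤ) * q) + u * (n + (u + - 1ℤ) * r) ≡
                        (ε + n) + (u + - 1ℤ) * ((q + n) + u * r)
  lemma = solve-∀
  proof : ∀ c → eval (raiseY u X Y) c ≡ (ε + n) + (eval u c + - 1ℤ) * eval (evalT ℤ[x]-Str t ρ) c
  proof c rewrite eval-raiseY u X Y c | hq c | hr c | eval-evalT t ρ c | eval-const n c =
    lemma (eval u c) (eval q c) (eval r c) ε n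

-- The k-th power of u + √(u² - 1). The congruence X ≡ 1 is carried along because each step adds the
-- residue of X to that of Y.
pell-exists-ℕ : ∀ u k → Σ (List ℤ) λ X → Σ (List ℤ) λ Y → IsPell u X Y × Cong u X 1ℤ × Cong u Y (pos k)
pell-exists-ℕ u zero =
  const 1ℤ , [] , (λ c → trans (cong₂ _*_ (eval-const 1ℤ c) (eval-const 1ℤ c)) (lemma₁ (eval u c))) ,
  mod [] (λ c → trans (eval-const 1ℤ c) (lemma₂ 1ℤ (eval u c))) , mod [] (λ c → lemma₂ 0ℤ (eval u c))
  where
  lemma₁ : ∀ u → 1ℤ * 1ℤ ≡ (u * u + - 1ℤ) * (0ℤ * 0ℤ) + 1ℤ
  lemma₁ = solve-∀
  lemma₂ : ∀ a u → a ≡ a + (u + - 1ℤ) * 0ℤ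
  lemma₂ = solve-∀
pell-exists-ℕ u (suc k) =
  let X , Y , h , cX , cY = pell-exists-ℕ u k in
  raiseX u X Y , raiseY u X Y , raise-IsPell u X Y h ,
  raiseX-Cong u X Y cX cY , raiseY-Cong u X Y cX cY

pell-exists : ∀ u n → Σ (List ℤ) λ X → Σ (List ℤ) λ Y → IsPell u X Y × Cong u Y n
pell-exists u (pos k) = let X , Y , h , _ , cY = pell-exists-ℕ u k in X , Y , h , cY
pell-exists u -[1+ k ] =
  let X , Y , h , _ , cY = pell-exists-ℕ u (suc k) in
  X , pneg Y , neg-IsPell u X Y h , neg-Cong u Y (pos (suc k)) cY

abstract
  const-isInteger : ∀ {j} (ρ : Fin j → List ℤ) i n → ρ i ≋ const n → Sat ℤ[x]-Str (isInteger i) ρ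
  const-isInteger ρ i n ρi≋n u =
    let X , Y , h , mod r hr = pell-exists u n in
    X , Y ,
    pointwise-≋ (var 1F ⊗ var 1F) (pellRHS (var 2F) (var 0F)) (Y V.∷ X V.∷ u V.∷ V.[]) h ,
    r ,
    pointwise-≋ ((var 1F ⊕ (⊖ 𝟙)) ⊗ var 0F) (var 2F ⊕ (⊖ var 3F)) (r V.∷ u V.∷ Y V.∷ ρ i V.∷ V.[])
      λ c → trans (lemma n ((eval u c + - 1ℤ) * eval r c))
              (cong₂ (λ y f → y + - f) (sym (hr c))
                     (sym (trans (eval-cong (ρ i) (const n) ρi≋n c) (eval-const n c))))
    where
    lemma : ∀ n x → x ≡ (n + x) + - n
    lemma = solve-∀

x+x≡0⇒x≡0 : ∀ x → x + x ≡ 0ℤ → x ≡ 0ℤ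
x+x≡0⇒x≡0 x h = *-cancelˡ-zero (pos 2) (λ ()) (trans (lemma x) h)
  where
  lemma : ∀ x → pos 2 * x ≡ x + x
  lemma = solve-∀

-- The degrees of A and B add up to at most 2d while the larger one exceeds m + d.
small-factor : ∀ A B U Y m d → HasDegree U (suc m) → HasDegree Y d →
               pmul A B ≋ padd (const 1ℤ) (pneg (pmul Y Y)) → B ≋ padd A (padd (pmul U Y) (pmul U Y)) →
               Below A d ⊎ Below B d
small-factor A B U Y m d degU degY AB B-A with degree A | degree B
... | inj₁ A≋0 | _ = inj₁ λ i _ → A≋0 i
... | inj₂ _ | inj₁ B≋0 = inj₂ λ i _ → B≋0 i
... | inj₂ (k , degA) | inj₂ (l , degB) with k ℕ.<? d | l ℕ.<? d
...   | yes k<d | _ = inj₁ λ i d≤i → proj₂ degA i (ℕ.≤-trans k<d d≤i)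
...   | no _ | yes l<d = inj₂ λ i d≤i → proj₂ degB i (ℕ.≤-trans l<d d≤i)
...   | no k≮d | no l≮d = contradiction vanish (proj₁ (HasDegree-pmul {A} {B} degA degB))
  where
  UY = coeff (pmul U Y) (suc m ℕ.+ d)

  large : suc d ℕ.+ d ℕ.≤ k ℕ.+ l
  large with suc m ℕ.+ d ℕ.≤? k | suc m ℕ.+ d ℕ.≤? l
  ... | yes a | _ = ℕ.+-mono-≤ (ℕ.≤-trans (s≤s (ℕ.m≤n+m d m)) a) (ℕ.≮⇒≥ l≮d)
  ... | no _ | yes b = subst (ℕ._≤ k ℕ.+ l) (ℕ.+-suc d d)
                         (ℕ.+-mono-≤ (ℕ.≮⇒≥ k≮d) (ℕ.≤-trans (s≤s (ℕ.m≤n+m d m)) b))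
  -- If both degrees stayed below that of uY, then B = A + 2uY would make twice the leading
  -- coefficient of uY vanish.
  ... | no a | no b = contradiction (x+x≡0⇒x≡0 UY (begin
      UY + UY                                           ≡⟨ coeff-padd (pmul U Y) _ _ ⟨
      coeff (padd (pmul U Y) (pmul U Y)) (suc m ℕ.+ d)  ≡⟨ ℤ.+-identityˡ _ ⟨
      0ℤ + coeff (padd (pmul U Y) (pmul U Y)) (suc m ℕ.+ d)
        ≡⟨ cong (_+ _) (sym (proj₂ degA _ (ℕ.≰⇒> a))) ⟩
      coeff A (suc m ℕ.+ d) + coeff (padd (pmul U Y) (pmul U Y)) (suc m ℕ.+ d)
                                                        ≡⟨ coeff-padd A _ _ ⟨
      coeff (padd A (padd (pmul U Y) (pmul U Y))) (suc m ℕ.+ d) ≡⟨ B-A _ ⟨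
      coeff B (suc m ℕ.+ d)                             ≡⟨ proj₂ degB _ (ℕ.≰⇒> b) ⟩
      0ℤ                                                ∎))
    (proj₁ (HasDegree-pmul {U} {Y} degU degY))

  const-below : ∀ a → Below (const a) 1
  const-below a (suc i) _ = refl

  vanish : coeff (pmul A B) (k ℕ.+ l) ≡ 0ℤ
  vanish = begin
    coeff (pmul A B) (k ℕ.+ l)                                   ≡⟨ AB _ ⟩
    coeff (padd (const 1ℤ) (pneg (pmul Y Y))) (k ℕ.+ l)          ≡⟨ coeff-padd (const 1ℤ) (pneg (pmul Y Y)) _ ⟩
    coeff (const 1ℤ) (k ℕ.+ l) + coeff (pneg (pmul Y Y)) (k ℕ.+ l)
      ≡⟨ cong₂ _+_ (const-below 1ℤ _ (ℕ.≤-trans (s≤s z≤n) large)) (coeff-pneg (pmul Y Y) _) ⟩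
    0ℤ + - coeff (pmul Y Y) (k ℕ.+ l)
      ≡⟨ cong (λ z → 0ℤ + - z) (Below-pmul Y Y (suc d) d (proj₂ degY) (proj₂ degY) _ large) ⟩
    0ℤ                                                           ∎

-- The end of the descent, where Y = 0. Since degrees add, X - 1 and X + 1 cannot both be nonzero.
sqrt-one : ∀ X → (∀ c → eval X c * eval X c ≡ 1ℤ) → Σ ℤ λ ε → X ≋ const ε
sqrt-one X h with degree (padd X (pneg (const 1ℤ))) | degree (padd X (const 1ℤ))
... | inj₁ z | _ = 1ℤ , pointwise-≋ (var 0F) 𝟙 (X V.∷ V.[])
        λ c → ℤ.i-j≡0⇒i≡j _ _ (≋-pointwise (var 0F ⊕ (⊖ 𝟙)) 𝟘 (X V.∷ V.[]) z c)
... | inj₂ _ | inj₁ z = - 1ℤ , pointwise-≋ (var 0F) (⊖ 𝟙) (X V.∷ V.[])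
        λ c → ℤ.i-j≡0⇒i≡j _ _ (≋-pointwise (var 0F ⊕ 𝟙) 𝟘 (X V.∷ V.[]) z c)
... | inj₂ (k , degA) | inj₂ (l , degB) = contradiction
        (pointwise-≋ ((var 0F ⊕ (⊖ 𝟙)) ⊗ (var 0F ⊕ 𝟙)) 𝟘 (X V.∷ V.[])
          (λ c → trans (factor (eval X c)) (ℤ.i≡j⇒i-j≡0 (h c))) (k ℕ.+ l))
        (proj₁ (HasDegree-pmul {padd X (pneg (const 1ℤ))} {padd X (const 1ℤ)} degA degB))
  where
  factor : ∀ x → (x + - 1ℤ) * (x + 1ℤ) ≡ x * x + - 1ℤ
  factor = solve-∀

-- The solution (X + Y √(u² − 1)) (u − √(u² − 1)).
lowerX lowerY : List ℤ → List ℤ → List ℤ → List ℤ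
lowerX u X Y = raiseX u X (pneg Y)
lowerY u X Y = pneg (raiseY u X (pneg Y))

raise-lower : ∀ u X Y → raiseX u (lowerX u X Y) (lowerY u X Y) ≋ X × raiseY u (lowerX u X Y) (lowerY u X Y) ≋ Y
raise-lower u X Y =
  eval-ext (raiseX u (lowerX u X Y) (lowerY u X Y)) X proofX ,
  eval-ext (raiseY u (lowerX u X Y) (lowerY u X Y)) Y proofY
  where
  lemmaX : ∀ u x y → u * (u * x + (u * u + - 1ℤ) * (- y)) + (u * u + - 1ℤ) * (- (x + u * (- y))) ≡ x
  lemmaX = solve-∀
  lemmaY : ∀ u x y → (u * x + (u * u + - 1ℤ) * (- y)) + u * (- (x + u * (- y))) ≡ y
  lemmaY = solve-∀
  proofX : ∀ c → eval (raiseX u (lowerX u X Y) (lowerY u X Y)) c ≡ eval X c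
  proofX c rewrite eval-raiseX u (lowerX u X Y) (lowerY u X Y) c | eval-raiseX u X (pneg Y) c
    | eval-pneg (raiseY u X (pneg Y)) c | eval-raiseY u X (pneg Y) c | eval-pneg Y c =
    lemmaX (eval u c) (eval X c) (eval Y c)
  proofY : ∀ c → eval (raiseY u (lowerX u X Y) (lowerY u X Y)) c ≡ eval Y c
  proofY c rewrite eval-raiseY u (lowerX u X Y) (lowerY u X Y) c | eval-raiseX u X (pneg Y) c
    | eval-pneg (raiseY u X (pneg Y)) c | eval-raiseY u X (pneg Y) c | eval-pneg Y c =
    lemmaY (eval u c) (eval X c) (eval Y c)

Cong-resp : ∀ u p q {ε} → p ≋ q → Cong u p ε → Cong u q ε
Cong-resp u p q p≋q (mod r h) = mod r λ c → trans (sym (eval-cong p q p≋q c)) (h c)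

module _ (u : List ℤ) {m} (degu : HasDegree u (suc m)) where

  Congs : List ℤ → List ℤ → Set
  Congs X Y = Σ ℤ λ ε → Σ ℤ λ n → Cong u X ε × Cong u Y n

  raise-Congs : ∀ X Y → Congs (lowerX u X Y) (lowerY u X Y) → Congs X Y
  raise-Congs X Y (ε , n , cX , cY) =
    let eX , eY = raise-lower u X Y in
    ε , ε + n , Cong-resp u (raiseX u (lowerX u X Y) (lowerY u X Y)) X eX
      (raiseX-Cong u (lowerX u X Y) (lowerY u X Y) cX cY) ,
    Cong-resp u (raiseY u (lowerX u X Y) (lowerY u X Y)) Y eY (raiseY-Cong u (lowerX u X Y) (lowerY u X Y) cX cY)

  lower-IsPell : ∀ X Y → IsPell u X Y → IsPell u (lowerX u X Y) (lowerY u X Y)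
  lower-IsPell X Y h = neg-IsPell u (lowerX u X Y) (raiseY u X (pneg Y))
                         (raise-IsPell u X (pneg Y) (neg-IsPell u X Y h))

  Below-pneg : ∀ p d → Below p d → Below (pneg p) d
  Below-pneg p d b i d≤i = trans (coeff-pneg p i) (cong (λ a → - a) (b i d≤i))

  neg-neg-Congs : ∀ X Y → Congs X (pneg Y) → Congs X Y
  neg-neg-Congs X Y (ε , n , cX , cY) =
    ε , - n , cX , Cong-resp u (pneg (pneg Y)) Y
      (λ i → trans (coeff-pneg (pneg Y) i) (trans (cong (λ a → - a) (coeff-pneg Y i)) (ℤ.neg-involutive _)))
      (neg-Cong u (pneg Y) n cY)

  -- For A = X - uY and B = X + uY the Pell equation reads A B = 1 - Y², and B - A = 2uY. Up to
  -- sign, A and B are the second components obtained by lowering (X, Y) and (X, - Y), so one of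
  -- these two lowerings decreases the degree.
  lower-small : ∀ X Y d → HasDegree Y d → IsPell u X Y →
                Below (raiseY u X (pneg Y)) d ⊎ Below (raiseY u X Y) d
  lower-small X Y d degY h = small-factor (raiseY u X (pneg Y)) (raiseY u X Y) u Y m d degu degY
    (pointwise-≋ ((var 1F ⊕ (var 0F ⊗ (⊖ var 2F))) ⊗ (var 1F ⊕ (var 0F ⊗ var 2F)))
                 (𝟙 ⊕ (⊖ (var 2F ⊗ var 2F))) (u V.∷ X V.∷ Y V.∷ V.[])
      λ c → trans (expand (eval u c) (eval X c) (eval Y c))
              (trans (cong (_+ - (eval u c * eval u c * (eval Y c * eval Y c))) (h c))
                     (collect (eval u c) (eval Y c))))
    (pointwise-≋ (var 1F ⊕ (var 0F ⊗ var 2F))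
                 ((var 1F ⊕ (var 0F ⊗ (⊖ var 2F))) ⊕ ((var 0F ⊗ var 2F) ⊕ (var 0F ⊗ var 2F)))
                 (u V.∷ X V.∷ Y V.∷ V.[])
      λ c → shift (eval u c) (eval X c) (eval Y c))
    where
    expand : ∀ u x y → (x + u * (- y)) * (x + u * y) ≡ x * x + - (u * u * (y * y))
    expand = solve-∀
    collect : ∀ u y → ((u * u + - 1ℤ) * (y * y) + 1ℤ) + - (u * u * (y * y)) ≡ 1ℤ + - (y * y)
    collect = solve-∀
    shift : ∀ u x y → x + u * y ≡ (x + u * (- y)) + (u * y + u * y)
    shift = solve-∀

  -- Descent: lowering (X, Y) or (X, - Y) decreases the degree of the second component until it is
  -- 0, and raising carries the residues back. With a bound in place of the degree, a vanishing top
  -- coefficient is simply skipped.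
  pell-Congs : ∀ d X Y → Below Y d → IsPell u X Y → Congs X Y
  pell-Congs zero X Y Y<0 h =
    let ε , X≋ε = sqrt-one X (λ c → trans (h c)
                    (trans (cong (λ y → (eval u c * eval u c + - 1ℤ) * (y * y) + 1ℤ) (Y≡0 c)) (lemma₁ (eval u c))))
    in ε , 0ℤ , mod [] (λ c → trans (eval-cong X (const ε) X≋ε c) (trans (eval-const ε c) (lemma₂ ε (eval u c)))) ,
       mod [] (λ c → trans (Y≡0 c) (lemma₂ 0ℤ (eval u c)))
    where
    Y≡0 : ∀ c → eval Y c ≡ 0ℤ
    Y≡0 = eval-cong Y [] (λ i → Y<0 i z≤n)
    lemma₁ : ∀ u → (u * u + - 1ℤ) * (0ℤ * 0ℤ) + 1ℤ ≡ 1ℤ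
    lemma₁ = solve-∀
    lemma₂ : ∀ a u → a ≡ a + (u + - 1ℤ) * 0ℤ
    lemma₂ = solve-∀
  pell-Congs (suc d) X Y Y<d h with coeff Y d ℤ.≟ 0ℤ
  ... | yes z = pell-Congs d X Y below h
    where
    below : Below Y d
    below i d≤i with ℕ.m≤n⇒m<n∨m≡n d≤i
    ... | inj₁ d<i  = Y<d i d<i
    ... | inj₂ refl = z
  ... | no nz with lower-small X Y d (nz , Y<d) h
  ...   | inj₁ small = raise-Congs X Y
            (pell-Congs d (lowerX u X Y) (lowerY u X Y)
              (Below-pneg (raiseY u X (pneg Y)) d small) (lower-IsPell X Y h))
  ...   | inj₂ small = neg-neg-Congs X Y (raise-Congs X (pneg Y)
            (pell-Congs d (lowerX u X (pneg Y)) (lowerY u X (pneg Y))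
              (Below-pneg (raiseY u X (pneg (pneg Y))) d λ i d≤i → trans (same i) (small i d≤i))
              (lower-IsPell X (pneg Y) (neg-IsPell u X Y h))))
    where
    same : raiseY u X (pneg (pneg Y)) ≋ raiseY u X Y
    same = pointwise-≋ (var 1F ⊕ (var 0F ⊗ (⊖ (⊖ var 2F)))) (var 1F ⊕ (var 0F ⊗ var 2F)) (u V.∷ X V.∷ Y V.∷ V.[])
             λ c → cong (λ y → eval X c + eval u c * y) (ℤ.neg-involutive (eval Y c))

Below-length : ∀ p → Below p (length p)
Below-length []      i       _         = refl
Below-length (a ∷ p) (suc i) (s≤s le) = Below-length p i le

monomial : ℕ → List ℤ
monomial zero    = const 1ℤ
monomial (suc m) = 0ℤ ∷ monomial m

monomial-HasDegree : ∀ m → HasDegree (monomial m) m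
monomial-HasDegree zero    = (λ ()) , λ { (suc i) _ → refl }
monomial-HasDegree (suc m) = let l , b = monomial-HasDegree m in l , λ { (suc i) (s≤s le) → b i le }

HasDegree-minus-const : ∀ u m n → HasDegree u (suc m) → HasDegree (padd u (pneg (const n))) (suc m)
HasDegree-minus-const (a ∷ [])    m n (l , b) = contradiction refl l
HasDegree-minus-const []          m n (l , b) = contradiction refl l
HasDegree-minus-const (a ∷ a′ ∷ u) m n (l , b) = l , λ { (suc i) le → b (suc i) le }

abstract
  isInteger-const : ∀ {j} (ρ : Fin j → List ℤ) i → Sat ℤ[x]-Str (isInteger i) ρ → Σ ℤ λ n → ρ i ≋ const n
  -- The degree of u has to exceed that of f - n; the successor keeps u non-constant when f is the
  -- empty list.
  isInteger-const ρ i h with h (monomial (suc (length (ρ i))))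
  ... | X , Y , pell , r , hr with pell-Congs (monomial (suc (length (ρ i)))) (monomial-HasDegree _) (length Y) X Y
         (Below-length Y)
         (≋-pointwise (var 1F ⊗ var 1F) (pellRHS (var 2F) (var 0F))
         (Y V.∷ X V.∷ monomial (suc (length (ρ i))) V.∷ V.[]) pell)
  ...   | ε , n , _ , mod q hq = n , conclude (degree g)
    where
    f u g : List ℤ
    f = ρ i
    u = monomial (suc (length f))
    g = padd q (pneg r)

    u-1 : HasDegree (padd u (pneg (const 1ℤ))) (suc (length f))
    u-1 = HasDegree-minus-const u (length f) 1ℤ (monomial-HasDegree _)

    -- Write f - n as (Y - n) - (Y - f). The descent makes the first difference a multiple of u - 1,
    -- the formula the second.
    f-n : padd f (pneg (const n)) ≋ pmul (padd u (pneg (const 1ℤ))) g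
    f-n = pointwise-≋ (var 0F ⊕ (⊖ var 1F)) ((var 2F ⊕ (⊖ 𝟙)) ⊗ (var 3F ⊕ (⊖ var 4F)))
            (f V.∷ const n V.∷ u V.∷ q V.∷ r V.∷ V.[]) λ c → begin
              eval f c + - eval (const n) c  ≡⟨ cong (λ z → eval f c + - z) (eval-const n c) ⟩
              eval f c + - n                 ≡⟨ lemma₁ (eval f c) n (eval Y c) ⟩
              (eval Y c + - n) + - (eval Y c + - eval f c)
                ≡⟨ cong₂ (λ y z → (y + - n) + - z) (hq c) (sym (hr′ c)) ⟩
              ((n + (eval u c + - 1ℤ) * eval q c) + - n) + - ((eval u c + - 1ℤ) * eval r c)
                ≡⟨ lemma₂ n (eval u c) (eval q c) (eval r c) ⟩
              (eval u c + - 1ℤ) * (eval q c + - eval r c) ∎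
      where
      hr′ : ∀ c → (eval u c + - 1ℤ) * eval r c ≡ eval Y c + - eval f c
      hr′ = ≋-pointwise ((var 1F ⊕ (⊖ 𝟙)) ⊗ var 0F) (var 2F ⊕ (⊖ var 3F)) (r V.∷ u V.∷ Y V.∷ f V.∷ V.[]) hr
      lemma₁ : ∀ f n y → f + - n ≡ (y + - n) + - (y + - f)
      lemma₁ = solve-∀
      lemma₂ : ∀ n u q r → ((n + (u + - 1ℤ) * q) + - n) + - ((u + - 1ℤ) * r) ≡ (u + - 1ℤ) * (q + - r)
      lemma₂ = solve-∀

    f-n-below : Below (padd f (pneg (const n))) (suc (length f))
    f-n-below (suc j) (s≤s le) = begin
      coeff (padd f (pneg (const n))) (suc j) ≡⟨ coeff-padd f (pneg (const n)) (suc j) ⟩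
      coeff f (suc j) + 0ℤ                    ≡⟨ ℤ.+-identityʳ _ ⟩
      coeff f (suc j)                         ≡⟨ Below-length f (suc j) (ℕ.m≤n⇒m≤1+n le) ⟩
      0ℤ                                      ∎

    conclude : g ≋ [] ⊎ ∃ (HasDegree g) → f ≋ const n
    conclude (inj₁ g≋0) = eval-ext f (const n) λ c → ℤ.i-j≡0⇒i≡j _ _ (begin
      eval f c + - eval (const n) c
        ≡⟨ ≋-pointwise (var 0F ⊕ (⊖ var 1F)) ((var 2F ⊕ (⊖ 𝟙)) ⊗ var 3F) (f V.∷ const n V.∷ u V.∷ g V.∷ V.[]) f-n c ⟩
      (eval u c + - 1ℤ) * eval g c  ≡⟨ cong ((eval u c + - 1ℤ) *_) (eval-cong g [] g≋0 c) ⟩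
      (eval u c + - 1ℤ) * 0ℤ        ≡⟨ ℤ.*-zeroʳ (eval u c + - 1ℤ) ⟩
      0ℤ                            ∎)
    conclude (inj₂ (k , degg)) = contradiction
      (trans (sym (f-n _)) (f-n-below _ (ℕ.m≤m+n (suc (length f)) k)))
      (proj₁ (HasDegree-pmul {padd u (pneg (const 1ℤ))} {g} u-1 degg))

-- Sequence coding in ℤ

infix 4 _∣ℤ_
_∣ℤ_ : ℤ → ℤ → Set
a ∣ℤ b = Σ ℤ λ q → a * q ≡ b

∣⇒∣∣ : ∀ a b → a ∣ℤ b → ∣ a ∣ ℕ.∣ ∣ b ∣
∣⇒∣∣ a b (q , e) = ℤ.∣⇒∣ᵤ {a} {b} (ℤ.divides q (trans (sym e) (ℤ.*-comm a q)))

∣∣⇒∣ : ∀ a b → ∣ a ∣ ℕ.∣ ∣ b ∣ → a ∣ℤ b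
∣∣⇒∣ a b h = let ℤ.divides q e = ℤ.∣ᵤ⇒∣ {a} {b} h in q , trans (ℤ.*-comm a q) (sym e)

square : ∀ i → i * i ≡ pos (∣ i ∣ ℕ.* ∣ i ∣)
square (pos m)  = sym (ℤ.pos-* m m)
square -[1+ m ] = refl

∣i+i∣ : ∀ i → ∣ i + i ∣ ≡ 2 ℕ.* ∣ i ∣
∣i+i∣ i = trans (cong ∣_∣ (lemma i)) (ℤ.abs-* (pos 2) i)
  where
  lemma : ∀ i → i + i ≡ pos 2 * i
  lemma = solve-∀

divisor-of-2^ : ∀ n d → d ℕ.∣ 2 ^ n → Σ ℕ λ k → k ℕ.≤ n × d ≡ 2 ^ k
divisor-of-2^ zero    d h = 0 , z≤n , ℕ.∣1⇒≡1 h
divisor-of-2^ (suc n) d (ℕ.divides q e)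
  with euclidsLemma q d prime[2] (subst (2 ℕ.∣_) e (ℕ.m∣m*n (2 ^ n)))
... | inj₁ (ℕ.divides q′ refl) =
        let k , k≤n , d≡ = divisor-of-2^ n d (ℕ.divides q′ (ℕ.*-cancelˡ-≡ _ _ 2 (trans e (trans
                             (cong (ℕ._* d) (ℕ.*-comm q′ 2)) (ℕ.*-assoc 2 q′ d)))))
        in k , ℕ.m≤n⇒m≤1+n k≤n , d≡
... | inj₂ (ℕ.divides d′ refl) =
        let k , k≤n , d≡ = divisor-of-2^ n d′ (ℕ.divides q (ℕ.*-cancelˡ-≡ _ _ 2 (trans e (trans
                             (sym (ℕ.*-assoc q d′ 2)) (ℕ.*-comm (q ℕ.* d′) 2)))))
        in suc k , s≤s k≤n , trans (cong (ℕ._* 2) d≡) (ℕ.*-comm (2 ^ k) 2)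

-- The condition 2i ∣ E thus selects exactly n positions up to sign, those at which coefficients are
-- stored.
half-divisor-of-2^ : ∀ n i E → ∣ E ∣ ≡ 2 ^ n → i + i ∣ℤ E → Σ ℕ λ k → k ℕ.< n × ∣ i ∣ ≡ 2 ^ k
half-divisor-of-2^ n i E e h
  with divisor-of-2^ n (2 ℕ.* ∣ i ∣) (subst₂ ℕ._∣_ (∣i+i∣ i) e (∣⇒∣∣ (i + i) E h))
... | zero  , _   , odd = contradiction (ℕ.m*n≡1⇒m≡1 2 ∣ i ∣ odd) λ ()
... | suc k , k≤n , eq  = k , k≤n , ℕ.*-cancelˡ-≡ _ _ 2 eq

-- Every divisor is even or a unit: this characterises ± 2ⁿ, and 0 is excluded by its divisor 3.
IsPow2 : ℤ → Set
IsPow2 E = ∀ d → d ∣ℤ E → pos 2 ∣ℤ d ⊎ d ∣ℤ 1ℤ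

IsPow2⇒2^ : ∀ E → IsPow2 E → Σ ℕ λ n → ∣ E ∣ ≡ 2 ^ n
IsPow2⇒2^ E h = go ∣ E ∣ λ d d∣E → h′ d (h (pos d) (∣∣⇒∣ (pos d) E d∣E))
  where
  h′ : ∀ d → pos 2 ∣ℤ pos d ⊎ pos d ∣ℤ 1ℤ → 2 ℕ.∣ d ⊎ d ≡ 1
  h′ d (inj₁ x) = inj₁ (∣⇒∣∣ (pos 2) (pos d) x)
  h′ d (inj₂ x) = inj₂ (ℕ.∣1⇒≡1 (∣⇒∣∣ (pos d) 1ℤ x))

  Claim : ℕ → Set
  Claim m = (∀ d → d ℕ.∣ m → 2 ℕ.∣ d ⊎ d ≡ 1) → Σ ℕ λ n → m ≡ 2 ^ n

  step : ∀ m → (∀ {m′} → m′ ℕ.< m → Claim m′) → Claim m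
  step zero rec h with h 3 (3 ℕ.∣0)
  ... | inj₁ 2∣3 = contradiction 2∣3 (from-no (2 ℕ.∣? 3))
  ... | inj₂ ()
  step (suc m) rec h with h (suc m) ℕ.∣-refl
  ... | inj₂ e = 0 , e
  ... | inj₁ (ℕ.divides (suc q) e) =
    let n , q≡ = rec (subst (suc q ℕ.<_) (sym e) (ℕ.m<m*n (suc q) 2 (s≤s (s≤s z≤n))))
                     (λ d d∣q → h d (subst (d ℕ.∣_) (sym e) (ℕ.∣-trans d∣q (ℕ.m∣m*n 2))))
    in suc n , trans e (trans (ℕ.*-comm (suc q) 2) (cong (2 ℕ.*_) q≡))

  go : ∀ m → Claim m
  go = <-rec Claim step

2^⇒IsPow2 : ∀ E n → ∣ E ∣ ≡ 2 ^ n → IsPow2 E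
2^⇒IsPow2 E n e d h with divisor-of-2^ n ∣ d ∣ (subst (∣ d ∣ ℕ.∣_) e (∣⇒∣∣ d E h))
... | zero  , _ , eq = inj₂ (∣∣⇒∣ d 1ℤ (subst (ℕ._∣ 1) (sym eq) ℕ.∣-refl))
... | suc k , _ , eq = inj₁ (∣∣⇒∣ (pos 2) d (subst (2 ℕ.∣_) (sym eq) (ℕ.m∣m*n (2 ^ k))))

-- An order-free variant of Gödel's β: the value is singled out among the residues of s
-- modulo 1 + i² b by the condition that 1 + y² divides b, which bounds it.
-- The index enters only through its square, so i and − i have the same value.
Beta : ℤ → ℤ → ℤ → ℤ → Set
Beta s b i y = (1ℤ + y * y ∣ℤ b) × (1ℤ + (i * i) * b ∣ℤ s + - y)

Beta-∣∣ : ∀ {s b y} i j → ∣ i ∣ ≡ ∣ j ∣ → Beta s b i y → Beta s b j y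
Beta-∣∣ {s} {b} {y} i j e (d , h) = d , subst (λ z → 1ℤ + z * b ∣ℤ s + - y)
  (trans (square i) (trans (cong (λ a → pos (a ℕ.* a)) e) (sym (square j)))) h

-- For arbitrary s and b the relation `Beta` is not functional: b = 0 admits every y. Uniqueness is
-- therefore part of the notion.
BetaValue : ℤ → ℤ → ℤ → ℤ → Set
BetaValue s b i a = Beta s b i a × ∀ y → Beta s b i y → y ≡ a

-- The head of the list is stored at the largest index, so that tails keep their indices.
Stores : ℤ → ℤ → List ℤ → Set
Stores s b []      = ⊤
Stores s b (a ∷ p) = BetaValue s b (pos (2 ^ length p)) a × Stores s b p

-- Bézout coefficients and the Chinese remainder theorem

Coprime : ℤ → ℤ → Set
Coprime x y = Σ ℤ λ α → Σ ℤ λ β → x * α + y * β ≡ 1ℤ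

Coprime-* : ∀ x y z → Coprime x z → Coprime y z → Coprime (x * y) z
Coprime-* x y z (α , β , e) (α′ , β′ , e′) =
  α * α′ , (x * α) * β′ + β * (y * α′) + z * (β * β′) ,
  trans (lemma x y z α β α′ β′) (cong₂ _*_ e e′)
  where
  lemma : ∀ x y z α β α′ β′ →
    (x * y) * (α * α′) + z * ((x * α) * β′ + β * (y * α′) + z * (β * β′)) ≡ (x * α + z * β) * (y * α′ + z * β′)
  lemma = solve-∀

-- Both moduli generate w′ − w, hence its multiple b, hence 1.
Coprime-moduli : ∀ w w′ b → w′ + - w ∣ℤ b → Coprime (1ℤ + w * b) (1ℤ + w′ * b)
Coprime-moduli w w′ b (q , refl) = 1ℤ + - (w * q * w′) , w * w * q , lemma w w′ q
  where
  lemma : ∀ w w′ q → (1ℤ + w * ((w′ + - w) * q)) * (1ℤ + - (w * q * w′)) +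
                     (1ℤ + w′ * ((w′ + - w) * q)) * (w * w * q) ≡ 1ℤ
  lemma = solve-∀

modulus : ℤ → ℕ → ℤ
modulus b k = 1ℤ + (pos (2 ^ k) * pos (2 ^ k)) * b

Residues : ℤ → ℤ → List ℤ → Set
Residues b s []      = ⊤
Residues b s (a ∷ p) = (modulus b (length p) ∣ℤ s + - a) × Residues b s p

moduli : ℤ → List ℤ → ℤ
moduli b []      = 1ℤ
moduli b (a ∷ p) = modulus b (length p) * moduli b p

Residues-shift : ∀ b s p z → moduli b p ∣ℤ z → Residues b s p → Residues b (s + z) p
Residues-shift b s []      z _       _             = tt
Residues-shift b s (a ∷ p) z (w , refl) ((q , e) , r) =
  (q + moduli b p * w , trans (distrib (modulus b (length p)) q (moduli b p) w)
    (trans (cong (_+ (modulus b (length p) * moduli b p) * w) e)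
           (swap s a ((modulus b (length p) * moduli b p) * w)))) ,
  Residues-shift b s p _ (modulus b (length p) * w , rotate (modulus b (length p)) (moduli b p) w) r
  where
  distrib : ∀ m q M w → m * (q + M * w) ≡ m * q + (m * M) * w
  distrib = solve-∀
  swap : ∀ s a z → (s + - a) + z ≡ (s + z) + - a
  swap = solve-∀
  rotate : ∀ m M w → M * (m * w) ≡ (m * M) * w
  rotate = solve-∀

Coprime-moduli-product : ∀ b p z → (∀ k → k ℕ.< length p → Coprime (modulus b k) z) → Coprime (moduli b p) z
Coprime-moduli-product b []      z h = 1ℤ , 0ℤ , cong (1ℤ +_) (ℤ.*-zeroʳ z)
Coprime-moduli-product b (a ∷ p) z h = Coprime-* (modulus b (length p)) (moduli b p) z
  (h _ ℕ.≤-refl) (Coprime-moduli-product b p z λ k k<l → h k (ℕ.m≤n⇒m≤1+n k<l))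

chinese-remainder : ∀ b p → (∀ j k → j ℕ.< k → k ℕ.< length p → Coprime (modulus b j) (modulus b k)) →
                    ∃ λ s → Residues b s p
chinese-remainder b []      h = 0ℤ , tt
chinese-remainder b (a ∷ p) h =
  let s , r = chinese-remainder b p (λ j k j<k k<l → h j k j<k (ℕ.m≤n⇒m≤1+n k<l))
      M = moduli b p
      m = modulus b (length p)
      α , β , e = Coprime-moduli-product b p m (λ k k<l → h k (length p) k<l ℕ.≤-refl)
  -- As M α ≡ 1 modulo m, the correction replaces s by a modulo m and changes nothing modulo the
  -- factors of M.
  in s + M * (α * (a + - s)) ,
     ((s + - a) * β , (begin
       m * ((s + - a) * β)                        ≡⟨ pull m s a β (M * α) ⟩
       (s + - a) * ((M * α + m * β) + - (M * α))  ≡⟨ cong (λ z → (s + - a) * (z + - (M * α))) e ⟩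
       (s + - a) * (1ℤ + - (M * α))               ≡⟨ push s a M α ⟩
       (s + M * (α * (a + - s))) + - a            ∎)) ,
     Residues-shift b s p _ (α * (a + - s) , refl) r
  where
  pull : ∀ m s a β x → m * ((s + - a) * β) ≡ (s + - a) * ((x + m * β) + - x)
  pull = solve-∀
  push : ∀ s a M α → (s + - a) * (1ℤ + - (M * α)) ≡ (s + M * (α * (a + - s))) + - a
  push = solve-∀

2m≤1+m² : ∀ m → m ℕ.+ m ℕ.≤ suc (m ℕ.* m)
2m≤1+m² zero    = z≤n
2m≤1+m² (suc m) = subst (ℕ._≤ suc (suc m ℕ.* suc m)) (sym (ℕ.+-suc (suc m) m))
  (s≤s (s≤s (ℕ.+-monoʳ-≤ m (subst (m ℕ.≤_) (sym (ℕ.*-suc m m)) (ℕ.m≤m+n m (m ℕ.* m))))))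

∣1+i²∣ : ∀ i → ∣ 1ℤ + i * i ∣ ≡ suc (∣ i ∣ ℕ.* ∣ i ∣)
∣1+i²∣ i = cong (λ z → ∣ 1ℤ + z ∣) (square i)

module _ (B : ℕ) where
  private
    b : ℤ
    -- The factorial is divisible both by the numbers 1 + a² of the stored values and by the
    -- differences of squared indices that make the moduli coprime.
    b = pos (B !)

  ∣B! : ∀ m → suc m ℕ.≤ B → suc m ℕ.∣ B !
  ∣B! m m<B = ℕ.∣-trans (ℕ.m∣m*n (m !)) (ℕ.m≤n⇒m!∣n! m<B)

  bounded-value : ∀ y → 1ℤ + y * y ∣ℤ b → ∣ y ∣ ℕ.+ ∣ y ∣ ℕ.≤ B !
  bounded-value y h = ℕ.≤-trans (2m≤1+m² ∣ y ∣)
    (ℕ.∣⇒≤ {{B ℕ.!≢0}} (subst (ℕ._∣ B !) (∣1+i²∣ y) (∣⇒∣∣ (1ℤ + y * y) b h)))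

  B!<modulus : ∀ k → B ! ℕ.< ∣ modulus b k ∣
  B!<modulus k = subst (B ! ℕ.<_) (sym eq)
      (s≤s (ℕ.m≤n*m (B !) (2 ^ k ℕ.* 2 ^ k) {{ℕ.m*n≢0 (2 ^ k) (2 ^ k) {{ℕ.m^n≢0 2 k}} {{ℕ.m^n≢0 2 k}}}}))
    where
    eq : ∣ modulus b k ∣ ≡ suc ((2 ^ k ℕ.* 2 ^ k) ℕ.* B !)
    eq = cong (λ z → ∣ 1ℤ + z ∣)
           (trans (cong (_* b) (sym (ℤ.pos-* (2 ^ k) (2 ^ k)))) (sym (ℤ.pos-* (2 ^ k ℕ.* 2 ^ k) (B !))))

  -- A competing y is congruent to a modulo 1 + 4ᵏ b, while the difference y - a is at most b in
  -- absolute value, hence 0.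
  BetaValue-! : ∀ s k a → suc (∣ a ∣ ℕ.* ∣ a ∣) ℕ.≤ B → modulus b k ∣ℤ s + - a → BetaValue s b (pos (2 ^ k)) a
  BetaValue-! s k a small (q , e) = (a∣b , q , e) , unique
    where
    a∣b : 1ℤ + a * a ∣ℤ b
    a∣b = ∣∣⇒∣ (1ℤ + a * a) b (subst (ℕ._∣ B !) (sym (∣1+i²∣ a)) (∣B! _ small))

    difference : ∀ s y a → (s + - a) + - (s + - y) ≡ y + - a
    difference = solve-∀
    factor : ∀ m q r → m * q + - (m * r) ≡ m * (q + - r)
    factor = solve-∀

    halve : ∀ {x y z} → x ℕ.+ x ℕ.≤ z → y ℕ.+ y ℕ.≤ z → x ℕ.+ y ℕ.≤ z
    halve {x} {y} {z} hx hy with ℕ.≤-total x y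
    ... | inj₁ x≤y = ℕ.≤-trans (ℕ.+-monoˡ-≤ y x≤y) hy
    ... | inj₂ y≤x = ℕ.≤-trans (ℕ.+-monoʳ-≤ x y≤x) hx

    unique : ∀ y → Beta s b (pos (2 ^ k)) y → y ≡ a
    unique y (y∣b , r , e′) = ℤ.i-j≡0⇒i≡j y a (∣∣-small⇒≡0 (y + - a) (modulus b k) (q + - r)
      (ℕ.≤-<-trans (ℤ.∣i-j∣≤∣i∣+∣j∣ y a)
        (ℕ.≤-<-trans (halve {∣ y ∣} {∣ a ∣} (bounded-value y y∣b) (bounded-value a a∣b)) (B!<modulus k)))
      (trans (sym (difference s y a)) (trans (cong₂ (λ u v → u + - v) (sym e) (sym e′)) (factor (modulus b k) q r))))

  Coprime-moduli-! : ∀ j k → j ℕ.< k → 2 ^ k ℕ.* 2 ^ k ℕ.≤ B → Coprime (modulus b j) (modulus b k)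
  Coprime-moduli-! j k j<k small = Coprime-moduli (pos (2 ^ j) * pos (2 ^ j)) (pos (2 ^ k) * pos (2 ^ k)) b
    (subst (_∣ℤ b) δ-eq (∣∣⇒∣ (pos δ) b (∣B!′ δ 1≤δ (ℕ.≤-trans (ℕ.m∸n≤m _ (2 ^ j ℕ.* 2 ^ j)) small))))
    where
    δ : ℕ
    δ = 2 ^ k ℕ.* 2 ^ k ℕ.∸ 2 ^ j ℕ.* 2 ^ j

    lt : 2 ^ j ℕ.* 2 ^ j ℕ.< 2 ^ k ℕ.* 2 ^ k
    lt = ℕ.*-mono-< (ℕ.^-monoʳ-< 2 (s≤s (s≤s z≤n)) j<k) (ℕ.^-monoʳ-< 2 (s≤s (s≤s z≤n)) j<k)

    1≤δ : 1 ℕ.≤ δ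
    1≤δ = ℕ.m<n⇒0<n∸m lt

    ∣B!′ : ∀ m → 1 ℕ.≤ m → m ℕ.≤ B → m ℕ.∣ B !
    ∣B!′ (suc m) _ = ∣B! m

    δ-eq : pos δ ≡ pos (2 ^ k) * pos (2 ^ k) + - (pos (2 ^ j) * pos (2 ^ j))
    δ-eq = begin
      pos δ                                                      ≡⟨ ℤ.⊖-≥ (ℕ.<⇒≤ lt) ⟨
      _                                                          ≡⟨ ℤ.m-n≡m⊖n (2 ^ k ℕ.* 2 ^ k) (2 ^ j ℕ.* 2 ^ j) ⟨
      pos (2 ^ k ℕ.* 2 ^ k) + - pos (2 ^ j ℕ.* 2 ^ j)
        ≡⟨ cong₂ (λ x y → x + - y) (ℤ.pos-* (2 ^ k) _) (ℤ.pos-* (2 ^ j) _) ⟩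
      pos (2 ^ k) * pos (2 ^ k) + - (pos (2 ^ j) * pos (2 ^ j))  ∎

squares : List ℤ → ℕ
squares []      = 0
squares (a ∷ p) = suc (∣ a ∣ ℕ.* ∣ a ∣) ℕ.+ squares p

Stores-exists : ∀ p → Σ ℤ λ s → Σ ℤ λ b → Stores s b p
Stores-exists p = proj₁ residues , pos (B !) , stores p (ℕ.m≤m+n (squares p) _) (proj₂ residues)
  where
  N = 2 ^ length p ℕ.* 2 ^ length p
  -- `squares p` is at least every 1 + a², and N is at least every squared index.
  B = squares p ℕ.+ N

  index≤B : ∀ k → k ℕ.≤ length p → 2 ^ k ℕ.* 2 ^ k ℕ.≤ B
  index≤B k k≤l = ℕ.≤-trans (ℕ.*-mono-≤ (ℕ.^-monoʳ-≤ 2 k≤l) (ℕ.^-monoʳ-≤ 2 k≤l)) (ℕ.m≤n+m N (squares p))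

  residues : ∃ λ s → Residues (pos (B !)) s p
  residues = chinese-remainder (pos (B !)) p λ j k j<k k<l → Coprime-moduli-! B j k j<k (index≤B k (ℕ.<⇒≤ k<l))

  stores : ∀ q → squares q ℕ.≤ B → Residues (pos (B !)) (proj₁ residues) q → Stores (proj₁ residues) (pos (B !)) q
  stores []      _ _       = tt
  stores (a ∷ q) h (e , r) =
    BetaValue-! B (proj₁ residues) (length q) a (ℕ.m+n≤o⇒m≤o (suc (∣ a ∣ ℕ.* ∣ a ∣)) h) e ,
    stores q (ℕ.m+n≤o⇒n≤o (suc (∣ a ∣ ℕ.* ∣ a ∣)) h) r

-- The interpretation of ℤ[x] in ℤ

betaF : ∀ {n} → Term n → Term n → Term n → Term n → Formula n
betaF s b i y = dvd (𝟙 ⊕ (y ⊗ y)) b ∧f dvd (𝟙 ⊕ ((i ⊗ i) ⊗ b)) (s ⊕ (⊖ y))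

-- The triple (s, b, E) with E = ± 2ⁿ codes the polynomial of degree below n
-- whose coefficient of index k is the Beta-value at 2ⁿ⁻¹⁻ᵏ.
domF : Formula 3
domF = ∀f (dvd (var 0F) (var 3F) ⇒f (dvd (𝟙 ⊕ 𝟙) (var 0F) ∨f dvd (var 0F) 𝟙)) ∧f
       ∀f (dvd (var 0F ⊕ var 0F) (var 3F) ⇒f
           ∃f (betaF (var 2F) (var 3F) (var 1F) (var 0F) ∧f
               ∀f (betaF (var 3F) (var 4F) (var 2F) (var 0F) ⇒f (var 0F ≐ var 1F))))

IsCodeDom : ℤ → ℤ → ℤ → Set
IsCodeDom s b E = IsPow2 E × (∀ i → i + i ∣ℤ E → Σ ℤ λ d → BetaValue s b i d)

-- s′, b′ store the intermediate values of Horner's scheme for the evaluation at c.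
evalF : ∀ {n} → Fin n → Fin n → Fin n → Fin n → Term n → Formula n
evalF s b E c e = ∃f (∃f (betaF (var 1F) (var 0F) 𝟙 𝟘 ∧f
  (∀f (∀f (∀f (dvd (var 2F ⊕ var 2F) (var (5 ↑ʳ E)) ⇒f
               (betaF (var 4F) (var 3F) (var 2F) (var 1F) ⇒f
               (betaF (var (5 ↑ʳ s)) (var (5 ↑ʳ b)) (var 2F) (var 0F) ⇒f
                betaF (var 4F) (var 3F) (var 2F ⊕ var 2F) ((var (5 ↑ʳ c) ⊗ var 1F) ⊕ var 0F)))))) ∧f
   ∀f (betaF (var 2F) (var 1F) (var (3 ↑ʳ E)) (var 0F) ⇒f (var 0F ≐ weaken (weaken (weaken e)))))))

Eval : ℤ → ℤ → ℤ → ℤ → ℤ → Set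
Eval s b E c e = Σ ℤ λ s′ → Σ ℤ λ b′ → Beta s′ b′ 1ℤ 0ℤ ×
  (∀ i y d → i + i ∣ℤ E → Beta s′ b′ i y → Beta s b i d → Beta s′ b′ (i + i) (c * y + d)) ×
  (∀ y → Beta s′ b′ E y → y ≡ e)

Codes : ℤ → ℤ → ℤ → List ℤ → Set
Codes s b E p = ∣ E ∣ ≡ 2 ^ length p × Stores s b p

pos2^ : ∀ k → pos (2 ^ k) + pos (2 ^ k) ≡ pos (2 ^ suc k)
pos2^ k = trans (sym (ℤ.pos-+ (2 ^ k) (2 ^ k))) (cong (λ z → pos (2 ^ k ℕ.+ z)) (sym (ℕ.+-identityʳ (2 ^ k))))

double-∣ : ∀ E n k → ∣ E ∣ ≡ 2 ^ n → k ℕ.< n → pos (2 ^ k) + pos (2 ^ k) ∣ℤ E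
double-∣ E n k e k<n = subst (_∣ℤ E) (sym (pos2^ k)) (∣∣⇒∣ (pos (2 ^ suc k)) E
  (subst (2 ^ suc k ℕ.∣_) (sym e) (subst (λ m → 2 ^ suc k ℕ.∣ 2 ^ m) (ℕ.m+[n∸m]≡n k<n)
    (subst (2 ^ suc k ℕ.∣_) (sym (ℕ.^-distribˡ-+-* 2 (suc k) (n ℕ.∸ suc k))) (ℕ.m∣m*n (2 ^ (n ℕ.∸ suc k)))))))

abstract
  -- The exponent of E fixes the length, trailing zeros being allowed. The digits granted by the
  -- domain condition are collected from the leading coefficient, at index 1, down to the constant
  -- one.
  decode : ∀ s b E → IsCodeDom s b E → Σ (List ℤ) (Codes s b E)
  decode s b E (pow2 , digit) = let p , l , st = go n ℕ.≤-refl in p , trans E≡ (cong (2 ^_) (sym l)) , st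
    where
    n : ℕ
    n = proj₁ (IsPow2⇒2^ E pow2)
    E≡ : ∣ E ∣ ≡ 2 ^ n
    E≡ = proj₂ (IsPow2⇒2^ E pow2)
    go : ∀ k → k ℕ.≤ n → Σ (List ℤ) λ p → length p ≡ k × Stores s b p
    go zero    _   = [] , refl , tt
    go (suc k) k<n =
      let p , l , st = go k (ℕ.<⇒≤ k<n)
          d , v = digit (pos (2 ^ k)) (double-∣ E n k E≡ k<n)
      in d ∷ p , cong suc l , subst (λ k → BetaValue s b (pos (2 ^ k)) d) (sym l) v , st

BetaValue-∣∣ : ∀ {s b a} i j → ∣ i ∣ ≡ ∣ j ∣ → BetaValue s b i a → BetaValue s b j a
BetaValue-∣∣ {s} {b} {a} i j e (v , u) =
  Beta-∣∣ {s} {b} {a} i j e v , λ y h → u y (Beta-∣∣ {s} {b} {y} j i (sym e) h)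

Stores-lookup : ∀ s b p k → k ℕ.< length p → Stores s b p → Σ ℤ λ d → BetaValue s b (pos (2 ^ k)) d
Stores-lookup s b (a ∷ p) k (s≤s k≤l) (v , st) with ℕ.m≤n⇒m<n∨m≡n k≤l
... | inj₁ k<l  = Stores-lookup s b p k k<l st
... | inj₂ refl = a , v

Codes⇒IsCodeDom : ∀ s b E p → Codes s b E p → IsCodeDom s b E
Codes⇒IsCodeDom s b E p (e , st) = 2^⇒IsPow2 E (length p) e , λ i h →
  let k , k<l , i≡ = half-divisor-of-2^ (length p) i E e h
      d , v = Stores-lookup s b p k k<l st
  in d , BetaValue-∣∣ {s} {b} {d} (pos (2 ^ k)) i (sym i≡) v

-- The partial values of Horner's scheme, with its initial 0 as last entry. Once stored, 0 sits at
-- index 1 and the value of a tail q of p at index 2 to the power `length q`.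
trace : List ℤ → ℤ → List ℤ
trace []      c = 0ℤ ∷ []
trace (a ∷ p) c = eval (a ∷ p) c ∷ trace p c

length-trace : ∀ p c → length (trace p c) ≡ suc (length p)
length-trace []      c = refl
length-trace (a ∷ p) c = cong suc (length-trace p c)

trace-head : ∀ s b p c → Stores s b (trace p c) → BetaValue s b (pos (2 ^ length p)) (eval p c)
trace-head s b []      c (v , _) = v
trace-head s b (a ∷ p) c (v , _) =
  subst (λ k → BetaValue s b (pos (2 ^ k)) (eval (a ∷ p) c)) (length-trace p c) v

trace-zero : ∀ s b p c → Stores s b (trace p c) → BetaValue s b 1ℤ 0ℤ
trace-zero s b []      c (v , _)  = v
trace-zero s b (a ∷ p) c (_ , st) = trace-zero s b p c st

trace-step : ∀ s′ b′ s b p c → Stores s′ b′ (trace p c) → Stores s b p → ∀ k → k ℕ.< length p →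
             ∀ y d → Beta s′ b′ (pos (2 ^ k)) y → Beta s b (pos (2 ^ k)) d →
             Beta s′ b′ (pos (2 ^ suc k)) (c * y + d)
trace-step s′ b′ s b (a ∷ p) c T@(_ , st′) (v , st) k (s≤s k≤l) y d y-val d-val with ℕ.m≤n⇒m<n∨m≡n k≤l
... | inj₁ k<l  = trace-step s′ b′ s b p c st′ st k k<l y d y-val d-val
... | inj₂ refl = subst (Beta s′ b′ (pos (2 ^ suc k)))
  (trans (ℤ.+-comm a (c * eval p c))
         (sym (cong₂ (λ y d → c * y + d) (proj₂ (trace-head s′ b′ p c st′) y y-val) (proj₂ v d d-val))))
  (proj₁ (trace-head s′ b′ (a ∷ p) c T))

Eval-complete : ∀ s b E p c → Codes s b E p → Eval s b E c (eval p c)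
Eval-complete s b E p c (e , st) = s′ , b′ , proj₁ (trace-zero s′ b′ p c T) , step ,
  proj₂ (BetaValue-∣∣ {s′} {b′} {eval p c} (pos (2 ^ length p)) E (sym e) (trace-head s′ b′ p c T))
  where
  stored = Stores-exists (trace p c)
  s′ = proj₁ stored
  b′ = proj₁ (proj₂ stored)
  T = proj₂ (proj₂ stored)

  step : ∀ i y d → i + i ∣ℤ E → Beta s′ b′ i y → Beta s b i d → Beta s′ b′ (i + i) (c * y + d)
  step i y d h y-val d-val =
    let k , k<l , i≡ = half-divisor-of-2^ (length p) i E e h in
    Beta-∣∣ {s′} {b′} {c * y + d} (pos (2 ^ suc k)) (i + i) (sym (trans (∣i+i∣ i) (cong (2 ℕ.*_) i≡)))
      (trace-step s′ b′ s b p c T st k k<l y d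
        (Beta-∣∣ {s′} {b′} {y} i (pos (2 ^ k)) i≡ y-val)
        (Beta-∣∣ {s} {b} {d} i (pos (2 ^ k)) i≡ d-val))

Eval-sound : ∀ s b E p c e → Codes s b E p → Eval s b E c e → eval p c ≡ e
Eval-sound s b E p c e (E≡ , st) (s′ , b′ , start , step , end) =
  end (eval p c) (Beta-∣∣ {s′} {b′} {eval p c} (pos (2 ^ length p)) E (sym E≡) (horner p ℕ.≤-refl st))
  where
  -- Here q runs through the tails of p; s′ and b′ are arbitrary and tied to p only by the clauses
  -- of `Eval`.
  horner : ∀ q → length q ℕ.≤ length p → Stores s b q → Beta s′ b′ (pos (2 ^ length q)) (eval q c)
  horner []      _ _              = start
  horner (a ∷ q) l ((v , _) , st) = subst₂ (Beta s′ b′) (pos2^ (length q)) (ℤ.+-comm (c * eval q c) a)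
    (step (pos (2 ^ length q)) (eval q c) a (double-∣ E (length p) (length q) E≡ l) (horner q (ℕ.<⇒≤ l) st) v)

Eval⇔ : ∀ s b E p c e → Codes s b E p → Eval s b E c e ⇔ (eval p c ≡ e)
Eval⇔ s b E p c e code = mk⇔ (Eval-sound s b E p c e code)
  (λ eq → subst (Eval s b E c) eq (Eval-complete s b E p c code))

Codes-exist : ∀ p → Σ ℤ λ s → Σ ℤ λ b → Codes s b (pos (2 ^ length p)) p
Codes-exist p = let s , b , st = Stores-exists p in s , b , refl , st

eqF : Formula 6
eqF = ∀f (∀f (evalF 2F 3F 4F 1F (var 0F) ⇒f evalF 5F 6F 7F 1F (var 0F)))

plusF timesF : Formula 9
plusF = ∀f (∀f (∀f (evalF 3F 4F 5F 2F (var 1F) ⇒f (evalF 6F 7F 8F 2F (var 0F) ⇒f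
          evalF 9F (suc 9F) (suc (suc 9F)) 2F (var 1F ⊕ var 0F)))))
timesF = ∀f (∀f (∀f (evalF 3F 4F 5F 2F (var 1F) ⇒f (evalF 6F 7F 8F 2F (var 0F) ⇒f
           evalF 9F (suc 9F) (suc (suc 9F)) 2F (var 1F ⊗ var 0F)))))

negF : Formula 6
negF = ∀f (∀f (evalF 2F 3F 4F 1F (var 0F) ⇒f evalF 5F 6F 7F 1F (⊖ var 0F)))

ℤ[x]-code : Code 0 3
ℤ[x]-code = record
  { dom = domF ; eq = eqF ; plus = plusF ; times = timesF ; neg = negF
  ; zer = ∀f (evalF 1F 2F 3F 0F 𝟘) ; one = ∀f (evalF 1F 2F 3F 0F 𝟙) }

polynomial : (u : Fin 3 → ℤ) → IsCodeDom (u 0F) (u 1F) (u 2F) → List ℤ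
polynomial u d = proj₁ (decode (u 0F) (u 1F) (u 2F) d)

polynomial-Codes : ∀ u d → Codes (u 0F) (u 1F) (u 2F) (polynomial u d)
polynomial-Codes u d = proj₂ (decode (u 0F) (u 1F) (u 2F) d)

module _ (u : Fin 3 → ℤ) (d : IsCodeDom (u 0F) (u 1F) (u 2F)) where

  evaluate : ∀ {c e} → Eval (u 0F) (u 1F) (u 2F) c e → eval (polynomial u d) c ≡ e
  evaluate {c} {e} = Eval-sound (u 0F) (u 1F) (u 2F) (polynomial u d) c e (polynomial-Codes u d)

  evaluation : ∀ {c e} → eval (polynomial u d) c ≡ e → Eval (u 0F) (u 1F) (u 2F) c e
  evaluation {c} {e} = from (Eval⇔ (u 0F) (u 1F) (u 2F) (polynomial u d) c e (polynomial-Codes u d))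

Codes-functional : ∀ s b E p q → Codes s b E p → Codes s b E q → p ≋ q
Codes-functional s b E p q cp cq = eval-ext p q λ c →
  Eval-sound s b E p c (eval q c) cp (Eval-complete s b E q c cq)

polynomial-isCoordMap : ∀ p → IsCoordMap (interpret ℤ[x]-code ℤ-Str p) ℤ[x]-Str polynomial
polynomial-isCoordMap p = record
  { cm-surj = λ a →
      let s , b , c = Codes-exist a
          u = s V.∷ b V.∷ pos (2 ^ length a) V.∷ V.[]
          d = Codes⇒IsCodeDom s b (pos (2 ^ length a)) a c
      in u , d , Codes-functional s b (pos (2 ^ length a)) (polynomial u d) a (polynomial-Codes u d) c
  ; cm-eq = λ t u d e → mk⇔
      (λ h → eval-ext (polynomial t d) (polynomial u e) λ c →
        sym (evaluate u e (h c (eval (polynomial t d) c) (evaluation t d refl))))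
      (λ h c z H → evaluation u e (trans (sym (eval-cong (polynomial t d) (polynomial u e) h c)) (evaluate t d H)))
  ; cm-plus = λ t u v d e g → mk⇔
      (λ h → eval-ext (padd (polynomial t d) (polynomial u e)) (polynomial v g) λ c →
        trans (eval-padd (polynomial t d) (polynomial u e) c) (sym (evaluate v g
          (h c (eval (polynomial t d) c) (eval (polynomial u e) c) (evaluation t d refl) (evaluation u e refl)))))
      (λ h c y z H K → evaluation v g (trans
        (sym (eval-cong (padd (polynomial t d) (polynomial u e)) (polynomial v g) h c))
        (trans (eval-padd (polynomial t d) (polynomial u e) c) (cong₂ _+_ (evaluate t d H) (evaluate u e K)))))
  ; cm-times = λ t u v d e g → mk⇔
      (λ h → eval-ext (pmul (polynomial t d) (polynomial u e)) (polynomial v g) λ c →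
        trans (eval-pmul (polynomial t d) (polynomial u e) c) (sym (evaluate v g
          (h c (eval (polynomial t d) c) (eval (polynomial u e) c) (evaluation t d refl) (evaluation u e refl)))))
      (λ h c y z H K → evaluation v g (trans
        (sym (eval-cong (pmul (polynomial t d) (polynomial u e)) (polynomial v g) h c))
        (trans (eval-pmul (polynomial t d) (polynomial u e) c) (cong₂ _*_ (evaluate t d H) (evaluate u e K)))))
  ; cm-neg = λ t u d e → mk⇔
      (λ h → eval-ext (pneg (polynomial t d)) (polynomial u e) λ c →
        trans (eval-pneg (polynomial t d) c)
              (sym (evaluate u e (h c (eval (polynomial t d) c) (evaluation t d refl)))))
      (λ h c z H → evaluation u e (trans
        (sym (eval-cong (pneg (polynomial t d)) (polynomial u e) h c))
        (trans (eval-pneg (polynomial t d) c) (cong (λ a → - a) (evaluate t d H)))))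
  ; cm-zero = λ t d → mk⇔
      (λ h → eval-ext (polynomial t d) [] λ c → evaluate t d (h c))
      (λ h c → evaluation t d (eval-cong (polynomial t d) [] h c))
  ; cm-one = λ t d → mk⇔
      (λ h → eval-ext (polynomial t d) (const 1ℤ) λ c → trans (evaluate t d (h c)) (sym (eval-const 1ℤ c)))
      (λ h c → evaluation t d (trans (eval-cong (polynomial t d) (const 1ℤ) h c) (eval-const 1ℤ c)))
  }

ℤ[x]-in-ℤ : RegInterp ℤ[x]-Str ℤ-Str
ℤ[x]-in-ℤ = record
  { code = ℤ[x]-code ; φ = 𝟘 ≐ 𝟘 ; φ-nonempty = V.[] , refl ; coord = λ p _ → polynomial , polynomial-isCoordMap p }

-- The interpretation of ℤ in ℤ[x]

renameT : ∀ {m n} → (Fin m → Fin n) → Term m → Term n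
renameT f (var i) = var (f i)
renameT f (s ⊕ t) = renameT f s ⊕ renameT f t
renameT f (s ⊗ t) = renameT f s ⊗ renameT f t
renameT f (⊖ t)   = ⊖ renameT f t
renameT f 𝟘       = 𝟘
renameT f 𝟙       = 𝟙

lift : ∀ {m n} → (Fin m → Fin n) → Fin (suc m) → Fin (suc n)
lift f zero    = zero
lift f (suc i) = suc (f i)

∀ℤ ∃ℤ : ∀ {n} → Formula (suc n) → Formula n
∀ℤ φ = ∀f (isInteger 0F ⇒f φ)
∃ℤ φ = ∃f (isInteger 0F ∧f φ)

-- Only the variables in the image of f have to denote integers.
relativise : ∀ {m n} → (Fin m → Fin n) → Formula m → Formula n
relativise f (s ≐ t)  = renameT f s ≐ renameT f t
relativise f ⊥f       = ⊥f
relativise f (φ ∧f ψ) = relativise f φ ∧f relativise f ψ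
relativise f (φ ∨f ψ) = relativise f φ ∨f relativise f ψ
relativise f (φ ⇒f ψ) = relativise f φ ⇒f relativise f ψ
relativise f (∀f φ)   = ∀ℤ (relativise (lift f) φ)
relativise f (∃f φ)   = ∃ℤ (relativise (lift f) φ)

eval-≋const : ∀ p n → p ≋ const n → ∀ c → eval p c ≡ n
eval-≋const p n h c = trans (eval-cong p (const n) h c) (eval-const n c)

_represents_via_ : ∀ {m n} → (Fin n → List ℤ) → (Fin m → ℤ) → (Fin m → Fin n) → Set
ρ represents σ via f = ∀ i → ρ (f i) ≋ const (σ i)

eval-renameT : ∀ {m n} (f : Fin m → Fin n) {ρ σ} → ρ represents σ via f → ∀ t c →
               eval (evalT ℤ[x]-Str (renameT f t) ρ) c ≡ evalT ℤ-Str t σ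
eval-renameT f {ρ} {σ} R (var i) c = eval-≋const (ρ (f i)) (σ i) (R i) c
eval-renameT f {ρ} R (s ⊕ t) c = trans (eval-padd (evalT ℤ[x]-Str (renameT f s) ρ) _ c)
  (cong₂ _+_ (eval-renameT f R s c) (eval-renameT f R t c))
eval-renameT f {ρ} R (s ⊗ t) c = trans (eval-pmul (evalT ℤ[x]-Str (renameT f s) ρ) _ c)
  (cong₂ _*_ (eval-renameT f R s c) (eval-renameT f R t c))
eval-renameT f {ρ} R (⊖ t)   c = trans (eval-pneg (evalT ℤ[x]-Str (renameT f t) ρ) c)
  (cong (λ a → - a) (eval-renameT f R t c))
eval-renameT f R 𝟘       c = refl
eval-renameT f R 𝟙       c = eval-const 1ℤ c

represents-∷ : ∀ {m n} (f : Fin m → Fin n) {ρ σ p a} → p ≋ const a → ρ represents σ via f →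
               (p V.∷ ρ) represents (a V.∷ σ) via lift f
represents-∷ f r R zero    = r
represents-∷ f r R (suc i) = R i

abstract
  -- Bound variables cross by the two directions of the definability of ℤ. An integer may be given
  -- by any list with the right coefficients, so assignments are compared up to `≋`.
  relativise⇔ : ∀ {m n} (f : Fin m → Fin n) φ ρ σ → ρ represents σ via f →
                Sat ℤ-Str φ σ ⇔ Sat ℤ[x]-Str (relativise f φ) ρ
  relativise⇔ f (s ≐ t) ρ σ R = mk⇔
    (λ e → eval-ext (evalT ℤ[x]-Str (renameT f s) ρ) (evalT ℤ[x]-Str (renameT f t) ρ)
      λ c → trans (eval-renameT f R s c) (trans e (sym (eval-renameT f R t c))))
    (λ e → trans (sym (eval-renameT f R s 0ℤ)) (trans
      (eval-cong (evalT ℤ[x]-Str (renameT f s) ρ) (evalT ℤ[x]-Str (renameT f t) ρ) e 0ℤ) (eval-renameT f R t 0ℤ)))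
  relativise⇔ f ⊥f       ρ σ R = mk⇔ (λ ()) (λ ())
  relativise⇔ f (φ ∧f ψ) ρ σ R = mk⇔ (Product.map (to (relativise⇔ f φ ρ σ R)) (to (relativise⇔ f ψ ρ σ R)))
                                 (Product.map (from (relativise⇔ f φ ρ σ R)) (from (relativise⇔ f ψ ρ σ R)))
  relativise⇔ f (φ ∨f ψ) ρ σ R = mk⇔ (Sum.map (to (relativise⇔ f φ ρ σ R)) (to (relativise⇔ f ψ ρ σ R)))
                                 (Sum.map (from (relativise⇔ f φ ρ σ R)) (from (relativise⇔ f ψ ρ σ R)))
  relativise⇔ f (φ ⇒f ψ) ρ σ R = mk⇔ (λ h x → to (relativise⇔ f ψ ρ σ R) (h (from (relativise⇔ f φ ρ σ R) x)))
                                 (λ h x → from (relativise⇔ f ψ ρ σ R) (h (to (relativise⇔ f φ ρ σ R) x)))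
  relativise⇔ f (∀f φ) ρ σ R = mk⇔
    (λ h p int → let n , p≋n = isInteger-const (p V.∷ ρ) 0F int in
      to (relativise⇔ (lift f) φ (p V.∷ ρ) (n V.∷ σ) (represents-∷ f p≋n R)) (h n))
    (λ h n → from (relativise⇔ (lift f) φ (const n V.∷ ρ) (n V.∷ σ) (represents-∷ f (λ i → refl) R))
      (h (const n) (const-isInteger (const n V.∷ ρ) 0F n λ i → refl)))
  relativise⇔ f (∃f φ) ρ σ R = mk⇔
    (λ (n , h) → const n , const-isInteger (const n V.∷ ρ) 0F n (λ i → refl) ,
      to (relativise⇔ (lift f) φ (const n V.∷ ρ) (n V.∷ σ) (represents-∷ f (λ i → refl) R)) h)
    (λ (p , int , h) → let n , p≋n = isInteger-const (p V.∷ ρ) 0F int in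
      n , from (relativise⇔ (lift f) φ (p V.∷ ρ) (n V.∷ σ) (represents-∷ f p≋n R)) h)

-- Composition of polynomials and the definability of U(a)

substitute : List ℤ → List ℤ → List ℤ
substitute []      a = []
substitute (d ∷ p) a = padd (const d) (pmul a (substitute p a))

eval-substitute : ∀ p a k → eval (substitute p a) k ≡ eval p (eval a k)
eval-substitute []      a k = refl
eval-substitute (d ∷ p) a k = trans (eval-padd (const d) (pmul a (substitute p a)) k) (cong₂ _+_ (eval-const d k)
  (trans (eval-pmul a (substitute p a) k) (cong (eval a k *_) (eval-substitute p a k))))

-- For P = d + x p one has P(a) - P(c) = (a - c) p(a) + c (p(a) - p(c)), which gives the quotient
-- recursively.
factor-theorem : ∀ p a c → Σ (List ℤ) λ q → ∀ k →
                 (eval a k + - c) * eval q k ≡ eval p (eval a k) + - eval p c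
factor-theorem []      a c = [] , λ k → ℤ.*-zeroʳ (eval a k + - c)
factor-theorem (d ∷ p) a c with factor-theorem p a c
... | q , h = padd (substitute p a) (pmul (const c) q) , proof
  where
  lemma₁ : ∀ a c x q → (a + - c) * (x + c * q) ≡ (a + - c) * x + c * ((a + - c) * q)
  lemma₁ = solve-∀
  lemma₂ : ∀ d a c x y → (a + - c) * x + c * (x + - y) ≡ (d + a * x) + - (d + c * y)
  lemma₂ = solve-∀
  proof : ∀ k → (eval a k + - c) * eval (padd (substitute p a) (pmul (const c) q)) k ≡
                (d + eval a k * eval p (eval a k)) + - (d + c * eval p c)
  proof k rewrite eval-padd (substitute p a) (pmul (const c) q) k | eval-substitute p a k
                | eval-pmul (const c) q k | eval-const c k =
    trans (lemma₁ (eval a k) c (eval p (eval a k)) (eval q k))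
      (trans (cong (λ z → (eval a k + - c) * eval p (eval a k) + c * z) (h k))
             (lemma₂ d (eval a k) c (eval p (eval a k)) (eval p c)))

-- y = U(a) for the polynomial U coded by (s, b, E): for every integer c
-- the polynomial y is congruent to U(c) modulo a − c.
valueAtF : ∀ {n} → Fin n → Fin n → Fin n → Fin n → Fin n → Formula n
valueAtF s b E y a = ∀ℤ (∀ℤ (
  relativise ((2 ↑ʳ s) V.∷ (2 ↑ʳ b) V.∷ (2 ↑ʳ E) V.∷ 1F V.∷ 0F V.∷ V.[]) (evalF 0F 1F 2F 3F (var 4F)) ⇒f
  dvd (var (2 ↑ʳ a) ⊕ (⊖ var 1F)) (var (2 ↑ʳ y) ⊕ (⊖ var 0F))))

triple : {A : Set} → A → A → A → Fin 3 → A
triple x y z = x V.∷ y V.∷ z V.∷ V.[]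

represents-triple : ∀ {n} (ρ : Fin n → List ℤ) s b E s₀ b₀ E₀ → ρ s ≋ const s₀ → ρ b ≋ const b₀ → ρ E ≋ const E₀ →
  ρ represents (triple s₀ b₀ E₀) via triple s b E
represents-triple ρ s b E s₀ b₀ E₀ rs rb rE 0F = rs
represents-triple ρ s b E s₀ b₀ E₀ rs rb rE 1F = rb
represents-triple ρ s b E s₀ b₀ E₀ rs rb rE 2F = rE

abstract
  valueAt⇔ : ∀ {n} (ρ : Fin n → List ℤ) s b E y a s₀ b₀ E₀ p →
             ρ s ≋ const s₀ → ρ b ≋ const b₀ → ρ E ≋ const E₀ → Codes s₀ b₀ E₀ p →
             Sat ℤ[x]-Str (valueAtF s b E y a) ρ ⇔ (ρ y ≋ substitute p (ρ a))
  valueAt⇔ {n} ρ s b E y a s₀ b₀ E₀ p rs rb rE code = mk⇔ forth back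
    where
    g : Fin 5 → Fin (suc (suc n))
    g = (2 ↑ʳ s) V.∷ (2 ↑ʳ b) V.∷ (2 ↑ʳ E) V.∷ 1F V.∷ 0F V.∷ V.[]

    values₀ : ℤ → ℤ → Fin 5 → ℤ
    values₀ c e = s₀ V.∷ b₀ V.∷ E₀ V.∷ c V.∷ e V.∷ V.[]

    represents : ∀ (c e : List ℤ) c₀ e₀ → c ≋ const c₀ → e ≋ const e₀ →
      (e V.∷ c V.∷ ρ) represents values₀ c₀ e₀ via g
    represents c e c₀ e₀ rc re 0F = rs
    represents c e c₀ e₀ rc re 1F = rb
    represents c e c₀ e₀ rc re 2F = rE
    represents c e c₀ e₀ rc re 3F = rc
    represents c e c₀ e₀ rc re 4F = re

    forth : Sat ℤ[x]-Str (valueAtF s b E y a) ρ → ρ y ≋ substitute p (ρ a)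
    forth h = eval-ext (ρ y) (substitute p (ρ a)) λ k →
      -- For c = a(k) the divisor a - c vanishes at k, so divisibility forces y(k) = p(a(k)).
      let c = eval (ρ a) k
          e = eval p c
          q , hq = h (const c) (const-isInteger (const c V.∷ ρ) 0F c λ i → refl)
                     (const e) (const-isInteger (const e V.∷ const c V.∷ ρ) 0F e λ i → refl)
                     (to (relativise⇔ g (evalF 0F 1F 2F 3F (var 4F)) (const e V.∷ const c V.∷ ρ) (values₀ c e)
                       (represents (const c) (const e) c e (λ i → refl) (λ i → refl)))
                       (Eval-complete s₀ b₀ E₀ p c code))
          vanish = ≋-pointwise ((var 1F ⊕ (⊖ var 2F)) ⊗ var 0F) (var 3F ⊕ (⊖ var 4F))
                     (q V.∷ ρ a V.∷ const c V.∷ ρ y V.∷ const e V.∷ V.[]) hq k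
      in trans (ℤ.i-j≡0⇒i≡j (eval (ρ y) k) e (begin
           eval (ρ y) k + - e                  ≡⟨ cong (λ z → eval (ρ y) k + - z) (eval-const e k) ⟨
           eval (ρ y) k + - eval (const e) k   ≡⟨ vanish ⟨
           (c + - eval (const c) k) * eval q k ≡⟨ cong (_* eval q k) (ℤ.i≡j⇒i-j≡0 (sym (eval-const c k))) ⟩
           0ℤ                                  ∎))
         (sym (eval-substitute p (ρ a) k))

    back : ρ y ≋ substitute p (ρ a) → Sat ℤ[x]-Str (valueAtF s b E y a) ρ
    back h c int-c e int-e H =
      let c₀ , rc = isInteger-const (c V.∷ ρ) 0F int-c
          e₀ , re = isInteger-const (e V.∷ c V.∷ ρ) 0F int-e
          val = Eval-sound s₀ b₀ E₀ p c₀ e₀ code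
                  (from (relativise⇔ g (evalF 0F 1F 2F 3F (var 4F)) (e V.∷ c V.∷ ρ) (values₀ c₀ e₀)
                        (represents c e c₀ e₀ rc re)) H)
          q , hq = factor-theorem p (ρ a) c₀
      in q , pointwise-≋ ((var 1F ⊕ (⊖ var 2F)) ⊗ var 0F) (var 3F ⊕ (⊖ var 4F))
               (q V.∷ ρ a V.∷ c V.∷ ρ y V.∷ e V.∷ V.[]) λ k → begin
           (eval (ρ a) k + - eval c k) * eval q k
           ≡⟨ cong (λ z → (eval (ρ a) k + - z) * eval q k) (eval-≋const c c₀ rc k) ⟩
           (eval (ρ a) k + - c₀) * eval q k        ≡⟨ hq k ⟩
           eval p (eval (ρ a) k) + - eval p c₀     ≡⟨ cong₂ (λ x z → x + - z)
                                                        (trans (sym (eval-substitute p (ρ a) k))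
                                                               (sym (eval-cong (ρ y) (substitute p (ρ a)) h k)))
                                                        (trans val (sym (eval-≋const e e₀ re k))) ⟩
           eval (ρ y) k + - eval e k               ∎

-- The parameter a is admissible when U ↦ U(a) is onto with trivial kernel.
ontoF kernelF generatorF : Formula 1
ontoF = ∀f (∃ℤ (∃ℤ (∃ℤ (relativise (triple 2F 1F 0F) domF ∧f valueAtF 2F 1F 0F 3F 4F))))
-- `valueAtF` takes variables, so the zero polynomial enters as a bound variable with an equation.
kernelF = ∀f (∀ℤ (∀ℤ (∀ℤ ((var 3F ≐ 𝟘) ⇒f (relativise (triple 2F 1F 0F) domF ⇒f (valueAtF 2F 1F 0F 3F 4F ⇒f
  relativise (triple 2F 1F 0F) (∀f (evalF 1F 2F 3F 0F 𝟘))))))))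
generatorF = ontoF ∧f kernelF

-- This holds exactly for a = ± x + c. A trivial kernel amounts to injectivity since substitution is
-- additive.
IsGenerator : List ℤ → Set
IsGenerator a = (∀ y → Σ (List ℤ) λ p → y ≋ substitute p a) × (∀ p → substitute p a ≋ [] → p ≋ [])

generator⇒IsGenerator : ∀ ρ → Sat ℤ[x]-Str generatorF ρ → IsGenerator (ρ 0F)
generator⇒IsGenerator ρ (onto , kernel) = onto′ , kernel′
  where
  onto′ : ∀ y → Σ (List ℤ) λ p → y ≋ substitute p (ρ 0F)
  onto′ y =
    let s , int-s , b , int-b , E , int-E , d , v = onto y
        s₀ , rs = isInteger-const (s V.∷ y V.∷ ρ) 0F int-s
        b₀ , rb = isInteger-const (b V.∷ s V.∷ y V.∷ ρ) 0F int-b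
        E₀ , rE = isInteger-const (E V.∷ b V.∷ s V.∷ y V.∷ ρ) 0F int-E
        ρ′ = E V.∷ b V.∷ s V.∷ y V.∷ ρ
        p , code = decode s₀ b₀ E₀ (from (relativise⇔ (triple 2F 1F 0F) domF ρ′ (triple s₀ b₀ E₀)
                     (represents-triple ρ′ 2F 1F 0F s₀ b₀ E₀ rs rb rE)) d)
    in p , to (valueAt⇔ ρ′ 2F 1F 0F 3F 4F s₀ b₀ E₀ p rs rb rE code) v

  kernel′ : ∀ p → substitute p (ρ 0F) ≋ [] → p ≋ []
  kernel′ p h =
    let s₀ , b₀ , code = Codes-exist p
        E₀ = pos (2 ^ length p)
        ρs = const s₀ V.∷ [] V.∷ ρ
        ρb = const b₀ V.∷ ρs
        ρ′ = const E₀ V.∷ ρb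
        R = represents-triple ρ′ 2F 1F 0F s₀ b₀ E₀ (λ i → refl) (λ i → refl) (λ i → refl)
        zeros = from (relativise⇔ (triple 2F 1F 0F) (∀f (evalF 1F 2F 3F 0F 𝟘)) ρ′ (triple s₀ b₀ E₀) R)
          (kernel [] (const s₀) (const-isInteger ρs 0F s₀ λ i → refl) (const b₀) (const-isInteger ρb 0F b₀ λ i → refl)
            (const E₀) (const-isInteger ρ′ 0F E₀ λ i → refl) (λ i → refl)
            (to (relativise⇔ (triple 2F 1F 0F) domF ρ′ (triple s₀ b₀ E₀) R) (Codes⇒IsCodeDom s₀ b₀ E₀ p code))
            (from (valueAt⇔ ρ′ 2F 1F 0F 3F 4F s₀ b₀ E₀ p (λ i → refl) (λ i → refl) (λ i → refl) code)
              λ i → sym (h i)))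
    in eval-ext p [] λ c → Eval-sound s₀ b₀ E₀ p c 0ℤ code (zeros c)

indeterminate : List ℤ
indeterminate = monomial 1

substitute-indeterminate : ∀ p → substitute p indeterminate ≋ p
substitute-indeterminate p = eval-ext (substitute p indeterminate) p λ k →
  trans (eval-substitute p indeterminate k) (cong (eval p) (lemma k))
  where
  lemma : ∀ k → 0ℤ + k * (1ℤ + k * 0ℤ) ≡ k
  lemma = solve-∀

indeterminate-generator : Sat ℤ[x]-Str generatorF (indeterminate V.∷ V.[])
indeterminate-generator = onto , kernel
  where
  σ = indeterminate V.∷ V.[]

  onto : Sat ℤ[x]-Str ontoF σ
  onto y =
    let s₀ , b₀ , code = Codes-exist y
        E₀ = pos (2 ^ length y)
        ρs = const s₀ V.∷ y V.∷ σ
        ρb = const b₀ V.∷ ρs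
        ρ′ = const E₀ V.∷ ρb
        R = represents-triple ρ′ 2F 1F 0F s₀ b₀ E₀ (λ i → refl) (λ i → refl) (λ i → refl)
    in const s₀ , const-isInteger ρs 0F s₀ (λ i → refl) , const b₀ , const-isInteger ρb 0F b₀ (λ i → refl) ,
       const E₀ , const-isInteger ρ′ 0F E₀ (λ i → refl) ,
       to (relativise⇔ (triple 2F 1F 0F) domF ρ′ (triple s₀ b₀ E₀) R) (Codes⇒IsCodeDom s₀ b₀ E₀ y code) ,
       from (valueAt⇔ ρ′ 2F 1F 0F 3F 4F s₀ b₀ E₀ y (λ i → refl) (λ i → refl) (λ i → refl) code)
         λ i → sym (substitute-indeterminate y i)

  kernel : Sat ℤ[x]-Str kernelF σ
  kernel y s int-s b int-b E int-E y≋0 d v =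
    let s₀ , rs = isInteger-const (s V.∷ y V.∷ σ) 0F int-s
        b₀ , rb = isInteger-const (b V.∷ s V.∷ y V.∷ σ) 0F int-b
        E₀ , rE = isInteger-const (E V.∷ b V.∷ s V.∷ y V.∷ σ) 0F int-E
        ρ′ = E V.∷ b V.∷ s V.∷ y V.∷ σ
        R = represents-triple ρ′ 2F 1F 0F s₀ b₀ E₀ rs rb rE
        p , code = decode s₀ b₀ E₀ (from (relativise⇔ (triple 2F 1F 0F) domF ρ′ (triple s₀ b₀ E₀) R) d)
        y≋p = to (valueAt⇔ ρ′ 2F 1F 0F 3F 4F s₀ b₀ E₀ p rs rb rE code) v
    in to (relativise⇔ (triple 2F 1F 0F) (∀f (evalF 1F 2F 3F 0F 𝟘)) ρ′ (triple s₀ b₀ E₀) R)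
         λ c → from (Eval⇔ s₀ b₀ E₀ p c 0ℤ code) (eval-cong p []
           (λ i → trans (sym (substitute-indeterminate p i)) (trans (sym (y≋p i)) (y≋0 i))) c)

-- The parameter is carried for the composite on ℤ[x], whose coordinate map sends a code of U to
-- U(a).
ℤ-code : Code 1 1
ℤ-code = record
  { dom = isInteger 0F ; eq = var 0F ≐ var 1F
  ; plus = (var 0F ⊕ var 1F) ≐ var 2F ; times = (var 0F ⊗ var 1F) ≐ var 2F
  ; neg = (⊖ var 0F) ≐ var 1F ; zer = var 0F ≐ 𝟘 ; one = var 0F ≐ 𝟙 }

integer : ∀ a (u : Fin 1 → List ℤ) → Interp.Dom (interpret ℤ-code ℤ[x]-Str a) u → ℤ
integer a u d = proj₁ (isInteger-const (u V.++ a) 0F d)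

integer-≋ : ∀ a u d → u 0F ≋ const (integer a u d)
integer-≋ a u d = proj₂ (isInteger-const (u V.++ a) 0F d)

integer-isCoordMap : ∀ a → IsCoordMap (interpret ℤ-code ℤ[x]-Str a) ℤ-Str (integer a)
integer-isCoordMap a = record
  { cm-surj = λ n →
      let u = const n V.∷ V.[]
          d = const-isInteger (u V.++ a) 0F n (λ i → refl)
      in u , d , sym (integer-≋ a u d 0)
  -- On quantifier-free formulas `relativise` is a mere renaming, so the transfer between ℤ and ℤ[x]
  -- applies to the formulas of the code.
  ; cm-eq = λ t u d e → ⇔-sym (relativise⇔ first₂ (var 0F ≐ var 1F) (t V.++ (u V.++ a)) _ (two t u d e))
  ; cm-plus = λ t u v d e g → ⇔-sym (relativise⇔ (triple 0F 1F 2F) ((var 0F ⊕ var 1F) ≐ var 2F)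
                (t V.++ (u V.++ (v V.++ a))) _ (three t u v d e g))
  ; cm-times = λ t u v d e g → ⇔-sym (relativise⇔ (triple 0F 1F 2F) ((var 0F ⊗ var 1F) ≐ var 2F)
                (t V.++ (u V.++ (v V.++ a))) _ (three t u v d e g))
  ; cm-neg = λ t u d e → ⇔-sym (relativise⇔ first₂ ((⊖ var 0F) ≐ var 1F) (t V.++ (u V.++ a)) _ (two t u d e))
  ; cm-zero = λ t d → ⇔-sym (relativise⇔ (0F V.∷ V.[]) (var 0F ≐ 𝟘) (t V.++ a) (integer a t d V.∷ V.[])
                λ { 0F → integer-≋ a t d })
  ; cm-one = λ t d → ⇔-sym (relativise⇔ (0F V.∷ V.[]) (var 0F ≐ 𝟙) (t V.++ a) (integer a t d V.∷ V.[])
                λ { 0F → integer-≋ a t d })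
  }
  where
  three : ∀ t u v d e g → (t V.++ (u V.++ (v V.++ a)))
    represents triple (integer a t d) (integer a u e) (integer a v g) via triple 0F 1F 2F
  three t u v d e g 0F = integer-≋ a t d
  three t u v d e g 1F = integer-≋ a u e
  three t u v d e g 2F = integer-≋ a v g

  first₂ : Fin 2 → Fin 3
  first₂ = 0F V.∷ 1F V.∷ V.[]

  two : ∀ t u d e → (t V.++ (u V.++ a))
    represents (integer a t d V.∷ integer a u e V.∷ V.[]) via first₂
  two t u d e 0F = integer-≋ a t d
  two t u d e 1F = integer-≋ a u e

ℤ-in-ℤ[x] : RegInterp ℤ-Str ℤ[x]-Str
ℤ-in-ℤ[x] = record
  { code = ℤ-code ; φ = generatorF
  ; φ-nonempty = indeterminate V.∷ V.[] , indeterminate-generator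
  ; coord = λ a _ → integer a , integer-isCoordMap a }

-- The composite interpretations

module _ {a : List ℤ} (gen : IsGenerator a) where

  substitute-cong : ∀ p q → p ≋ q → substitute p a ≋ substitute q a
  substitute-cong p q h = eval-ext (substitute p a) (substitute q a) λ k →
    trans (eval-substitute p a k) (trans (eval-cong p q h (eval a k)) (sym (eval-substitute q a k)))

  substitute-injective : ∀ p q → substitute p a ≋ substitute q a → p ≋ q
  substitute-injective p q h = eval-ext p q λ c → ℤ.i-j≡0⇒i≡j (eval p c) (eval q c)
    (≋-pointwise (var 0F ⊕ (⊖ var 1F)) 𝟘 (p V.∷ q V.∷ V.[]) (proj₂ gen (padd p (pneg q)) vanish) c)
    where
    vanish : substitute (padd p (pneg q)) a ≋ []
    vanish = eval-ext (substitute (padd p (pneg q)) a) [] λ k → begin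
      eval (substitute (padd p (pneg q)) a) k       ≡⟨ eval-substitute (padd p (pneg q)) a k ⟩
      eval (padd p (pneg q)) (eval a k)             ≡⟨ eval-evalT (var 0F ⊕ (⊖ var 1F)) (p V.∷ q V.∷ V.[]) (eval a k) ⟩
      eval p (eval a k) + - eval q (eval a k)
        ≡⟨ cong₂ (λ x y → x + - y) (eval-substitute p a k) (eval-substitute q a k) ⟨
      eval (substitute p a) k + - eval (substitute q a) k
        ≡⟨ ℤ.i≡j⇒i-j≡0 (eval-cong (substitute p a) (substitute q a) h k) ⟩
      0ℤ                                            ∎

  substitute-≋⇔ : ∀ p p′ q → substitute p a ≋ p′ → (p ≋ q) ⇔ (p′ ≋ substitute q a)
  substitute-≋⇔ p p′ q e = mk⇔
    (λ h i → trans (sym (e i)) (substitute-cong p q h i))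
    (λ h → substitute-injective p q λ i → trans (e i) (h i))

  -- Substitution is a ring homomorphism, stated for all terms at once: the value of either side at
  -- k is that of the term at a(k).
  substitute-evalT : ∀ {n} (t : Term n) (ρ : Fin n → List ℤ) →
    substitute (evalT ℤ[x]-Str t ρ) a ≋ evalT ℤ[x]-Str t (λ i → substitute (ρ i) a)
  substitute-evalT t ρ =
    eval-ext (substitute (evalT ℤ[x]-Str t ρ) a) (evalT ℤ[x]-Str t (λ i → substitute (ρ i) a)) λ k → begin
    eval (substitute (evalT ℤ[x]-Str t ρ) a) k                  ≡⟨ eval-substitute (evalT ℤ[x]-Str t ρ) a k ⟩
    eval (evalT ℤ[x]-Str t ρ) (eval a k)                        ≡⟨ eval-evalT t ρ (eval a k) ⟩
    evalT ℤ-Str t (λ i → eval (ρ i) (eval a k))                 ≡⟨ evalT-cong t (λ i → sym (eval-substitute (ρ i) a k)) ⟩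
    evalT ℤ-Str t (λ i → eval (substitute (ρ i) a) k)           ≡⟨ eval-evalT t (λ i → substitute (ρ i) a) k ⟨
    eval (evalT ℤ[x]-Str t (λ i → substitute (ρ i) a)) k        ∎
    where
    evalT-cong : ∀ {n} (t : Term n) {σ τ : Fin n → ℤ} → (∀ i → σ i ≡ τ i) → evalT ℤ-Str t σ ≡ evalT ℤ-Str t τ
    evalT-cong (var i) h = h i
    evalT-cong (s ⊕ t) h = cong₂ _+_ (evalT-cong s h) (evalT-cong t h)
    evalT-cong (s ⊗ t) h = cong₂ _*_ (evalT-cong s h) (evalT-cong t h)
    evalT-cong (⊖ t)   h = cong (λ x → - x) (evalT-cong t h)
    evalT-cong 𝟘       h = refl
    evalT-cong 𝟙       h = refl

  -- For a generator, U ↦ U(a) is an automorphism of ℤ[x], and a coordinate map may be followed by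
  -- an automorphism. This replaces the decoded U, not definable from its code, by U(a), which is
  -- definable from the code and a.
  substitute-isCoordMap : ∀ {T} {I : Interp T} {f : (t : T) → Interp.Dom I t → List ℤ} →
                          IsCoordMap I ℤ[x]-Str f → IsCoordMap I ℤ[x]-Str (λ t d → substitute (f t d) a)
  substitute-isCoordMap {f = f} cm = record
    { cm-surj = λ y →
        let p , y≋p = proj₁ gen y
            t , d , e = C.cm-surj p
        in t , d , λ i → trans (substitute-cong (f t d) p e i) (sym (y≋p i))
    ; cm-eq = λ t u d e →
        substitute-≋⇔ (f t d) (substitute (f t d) a) (f u e) (λ i → refl) ⇔-∘ C.cm-eq t u d e
    ; cm-plus = λ t u v d e g →
        substitute-≋⇔ (padd (f t d) (f u e)) (padd (substitute (f t d) a) (substitute (f u e) a)) (f v g)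
          (substitute-evalT (var 0F ⊕ var 1F) (f t d V.∷ f u e V.∷ V.[])) ⇔-∘ C.cm-plus t u v d e g
    ; cm-times = λ t u v d e g →
        substitute-≋⇔ (pmul (f t d) (f u e)) (pmul (substitute (f t d) a) (substitute (f u e) a)) (f v g)
          (substitute-evalT (var 0F ⊗ var 1F) (f t d V.∷ f u e V.∷ V.[])) ⇔-∘ C.cm-times t u v d e g
    ; cm-neg = λ t u d e →
        substitute-≋⇔ (pneg (f t d)) (pneg (substitute (f t d) a)) (f u e)
          (substitute-evalT (⊖ var 0F) (f t d V.∷ V.[])) ⇔-∘ C.cm-neg t u d e
    ; cm-zero = λ t d → ≋-swap (substitute (f t d) a) [] ⇔-∘
        (substitute-≋⇔ [] [] (f t d) (λ i → refl) ⇔-∘ (≋-swap [] (f t d) ⇔-∘ C.cm-zero t d))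
    ; cm-one = λ t d → ≋-swap (substitute (f t d) a) (const 1ℤ) ⇔-∘
        (substitute-≋⇔ (const 1ℤ) (const 1ℤ) (f t d) (substitute-evalT 𝟙 V.[]) ⇔-∘
         (≋-swap (const 1ℤ) (f t d) ⇔-∘ C.cm-one t d))
    }
    where
    module C = IsCoordMap cm
    ≋-swap : ∀ p q → (q ≋ p) ⇔ (p ≋ q)
    ≋-swap p q = mk⇔ (λ h i → sym (h i)) (λ h i → sym (h i))

ℤ[x]-self-coordinates : ∀ z q → Composite.Admissible ℤ[x]-in-ℤ ℤ-in-ℤ[x] z q →
                        Composite.Defines ℤ[x]-in-ℤ ℤ-in-ℤ[x] (valueAtF 0F 1F 2F 3F 4F) z q
ℤ[x]-self-coordinates z q (generator , _) =
  (λ u d → substitute (compose u d) (z 0F)) ,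
  substitute-isCoordMap (generator⇒IsGenerator z generator) isCoordMap-compose ,
  λ u d x → valueAt⇔ (flat u V.++ (x V.∷ (z V.++ flat q))) 0F 1F 2F 3F 4F
    (coordinates u d 0F) (coordinates u d 1F) (coordinates u d 2F) (compose u d)
    (integer-≋ z (u 0F) (proj₁ d 0F)) (integer-≋ z (u 1F) (proj₁ d 1F)) (integer-≋ z (u 2F) (proj₁ d 2F))
    (polynomial-Codes (coordinates u d) (dom u d))
  where
  open Reduction.Composition ℤ-isCongruent (integer-isCoordMap z) ℤ[x]-isCongruent ℤ[x]-code {q} {V.[]} (λ ())
    (polynomial-isCoordMap V.[])

-- In the composite on ℤ an integer is represented by a code of a constant polynomial, so it is
-- recovered as the value at every point.
constantF : Formula 7
constantF = ∀f (evalF 1F 2F 3F 0F (var 4F))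

ℤ-self-coordinates : ∀ z q → Composite.Admissible ℤ-in-ℤ[x] ℤ[x]-in-ℤ z q →
                     Composite.Defines ℤ-in-ℤ[x] ℤ[x]-in-ℤ constantF z q
ℤ-self-coordinates z q (_ , q∈dom , _) =
  compose , isCoordMap-compose ,
  λ u d x →
    let n = integer-≋ p (coordinates u d) (dom u d) in
    mk⇔ (λ h → trans (sym (evaluate (u 0F) (proj₁ d 0F) (h 0ℤ)))
                 (eval-≋const (coordinates u d 0F) (compose u d) n 0ℤ))
        (λ h k → evaluation (u 0F) (proj₁ d 0F)
                   (trans (eval-≋const (coordinates u d 0F) (compose u d) n k) (sym h)))
  where
  p : Fin 1 → List ℤ
  p i = polynomial (q i) (q∈dom i)

  open Reduction.Composition ℤ[x]-isCongruent (polynomial-isCoordMap z) ℤ-isCongruent ℤ-code {q} {p}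
    (λ i → q∈dom i , λ j → refl) (integer-isCoordMap p)

theorem6p1 : RegBiInterp ℤ[x]-Str ℤ-Str
theorem6p1 = record
  { Γ = ℤ[x]-in-ℤ ; Δ = ℤ-in-ℤ[x]
  ; θA = valueAtF 0F 1F 2F 3F 4F ; θB = constantF
  ; θA-ok = ℤ[x]-self-coordinates ; θB-ok = ℤ-self-coordinates }
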